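{- There is a constant $C$ such that for every sufficiently large $n$ there exists a $C_4$-free $2$-planar graph on $n$ vertices with at least $2.5n-C$ edges.
   Context: All graphs are finite and simple. A graph is $k$-planar if it admits a drawing in the plane in which every edge is crossed at most $k$ times. A graph is $C_\ell$-free if it contains no cycle of length $\ell$ as a subgraph. (The paper states the edge count as $2.5n-O(1)$.) -}

module Defs where

open import Data.Bool using (Bool; false; T)
open import Data.Bool.Properties using (T?)
open import Data.Fin as Fin using (Fin; toℕ)
import Data.Fin.Properties as Fin
open import Data.Integer using (+_)
open import Data.List using (List; allFin; cartesianProduct; filter; length)
open import Data.Nat as ℕ using (ℕ; suc)
open import Data.Nat.DivMod using (_mod_)
open import Data.Product using (Σ; ∃-syntax; _×_; _,_)
open import Data.Rational using (ℚ; 0ℚ; 1ℚ; _/_; _+_; _-_; ∣_∣; _≤_; _<_)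
import Data.Rational.Properties as ℚ
open import Function.Definitions using (Injective)
open import Relation.Binary.PropositionalEquality using (_≡_; _≢_; sym; cong; subst)
open import Relation.Nullary using (¬_)
open import Relation.Nullary.Decidable using (_×-dec_; toWitness)

-- Real numbers are Bishop's regular sequences of rationals,
-- with the rate of convergence given by inv.
inv : ℕ → ℚ
inv n = + 1 / suc n

-- The n-th approximation is within 1/(n+1) of the real number.
record ℝ : Set where
  field
    approx  : ℕ → ℚ
    regular : ∀ m n → ∣ approx m - approx n ∣ ≤ inv m + inv n

open ℝ public

infix 4 _≤ℝ_ _<ℝ_ _≈ℝ_

_≤ℝ_ : ℝ → ℝ → Set
x ≤ℝ y = ∀ n → approx x n ≤ approx y n + (inv n + inv n)

_<ℝ_ : ℝ → ℝ → Set
x <ℝ y = ∃[ n ] approx x n + (inv n + inv n) < approx y n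

-- |x - y| ≤ ε
Within : ℚ → ℝ → ℝ → Set
Within ε x y = ∀ n → ∣ approx x n - approx y n ∣ ≤ ε + (inv n + inv n)

_≈ℝ_ : ℝ → ℝ → Set
x ≈ℝ y = Within 0ℚ x y

inv+inv-nonNeg : ∀ m n → 0ℚ ≤ inv m + inv n
inv+inv-nonNeg m n = ℚ.+-mono-≤ (0≤inv m) (0≤inv n)
  where
  0≤inv : ∀ k → 0ℚ ≤ inv k
  0≤inv k = ℚ.nonNegative⁻¹ (inv k) {{ℚ.normalize-nonNeg 1 (suc k)}}

fromℚ : ℚ → ℝ
fromℚ q .approx  _   = q
fromℚ q .regular m n = subst (_≤ inv m + inv n)
  (sym (cong ∣_∣ (ℚ.+-inverseʳ q))) (inv+inv-nonNeg m n)

fromℚ-mono-≤ : ∀ {p q} → p ≤ q → fromℚ p ≤ℝ fromℚ q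
fromℚ-mono-≤ {p} {q} p≤q n = subst (_≤ q + (inv n + inv n))
  (ℚ.+-identityʳ p) (ℚ.+-mono-≤ p≤q (inv+inv-nonNeg n n))

0ℝ 1ℝ : ℝ
0ℝ = fromℚ 0ℚ
1ℝ = fromℚ 1ℚ

record Point : Set where
  constructor point
  field
    x-coord y-coord : ℝ

open Point public

WithinPt : ℚ → Point → Point → Set
WithinPt ε p q = Within ε (x-coord p) (x-coord q) × Within ε (y-coord p) (y-coord q)

infix 4 _≈Pt_

_≈Pt_ : Point → Point → Set
p ≈Pt q = x-coord p ≈ℝ x-coord q × y-coord p ≈ℝ y-coord q

record Interval : Set where
  field
    value : ℝ
    lower : 0ℝ ≤ℝ value
    upper : value ≤ℝ 1ℝ

open Interval public

infix 4 _≈I_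

_≈I_ : Interval → Interval → Set
s ≈I t = value s ≈ℝ value t

Interior : Interval → Set
Interior t = 0ℝ <ℝ value t × value t <ℝ 1ℝ

0≤1 : 0ℚ ≤ 1ℚ
0≤1 = toWitness {a? = 0ℚ ℚ.≤? 1ℚ} _

0I 1I : Interval
0I = record { value = 0ℝ ; lower = fromℚ-mono-≤ ℚ.≤-refl ; upper = fromℚ-mono-≤ 0≤1 }
1I = record { value = 1ℝ ; lower = fromℚ-mono-≤ 0≤1 ; upper = fromℚ-mono-≤ ℚ.≤-refl }

-- Continuity on the compact interval is stated uniformly, as is usual over
-- constructive reals; in particular `curve` respects ≈I.
record Arc (p q : Point) : Set where
  field
    curve      : Interval → Point
    continuous : ∀ ε → 0ℚ < ε → ∃[ δ ] (0ℚ < δ ×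
                   (∀ s t → Within δ (value s) (value t) → WithinPt ε (curve s) (curve t)))
    injective  : Injective _≈I_ _≈Pt_ curve
    source     : curve 0I ≈Pt p
    target     : curve 1I ≈Pt q

open Arc public using (curve)

record Graph (n : ℕ) : Set where
  field
    adj         : Fin n → Fin n → Bool
    symmetric   : ∀ u v → adj u v ≡ adj v u
    irreflexive : ∀ v → adj v v ≡ false

  Adj : Fin n → Fin n → Set
  Adj u v = T (adj u v)

  -- Each undirected edge is represented once, with its smaller endpoint first;
  -- both proof components are propositions.
  record Edge : Set where
    field
      {src tgt} : Fin n
      src<tgt   : src Fin.< tgt
      adjacent  : Adj src tgt

  edgeList : List (Fin n × Fin n)
  edgeList = filter (λ (u , v) → (u Fin.<? v) ×-dec T? (adj u v))
                    (cartesianProduct (allFin n) (allFin n))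

  edgeCount : ℕ
  edgeCount = length edgeList

open Graph public using (Edge; edgeCount)

cyclicSuc : ∀ {ℓ} → .{{_ : ℕ.NonZero ℓ}} → Fin ℓ → Fin ℓ
cyclicSuc {ℓ} i = suc (toℕ i) mod ℓ

-- Intended for ℓ ≥ 3.
record Cycle (ℓ : ℕ) .{{_ : ℕ.NonZero ℓ}} {n : ℕ} (G : Graph n) : Set where
  field
    vertex   : Fin ℓ → Fin n
    distinct : Injective _≡_ _≡_ vertex
    adjacent : ∀ i → Graph.Adj G (vertex i) (vertex (cyclicSuc i))

CycleFree : (ℓ : ℕ) → .{{_ : ℕ.NonZero ℓ}} → {n : ℕ} → Graph n → Set
CycleFree ℓ G = ¬ Cycle ℓ G

record Drawing {n : ℕ} (G : Graph n) : Set where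
  field
    position        : Fin n → Point
    distinct        : Injective _≡_ _≈Pt_ position
    arc             : (e : Edge G) → Arc (position (Edge.src e)) (position (Edge.tgt e))
    avoids-vertices : ∀ e t → Interior t → ∀ w → ¬ (curve (arc e) t ≈Pt position w)

  -- Every common interior point of two distinct edges counts as a crossing;
  -- a point lying on several other edges counts once for each of them.
  record Crossing (e : Edge G) : Set where
    field
      other          : Edge G
      other≢         : other ≢ e
      param          : Interval
      otherParam     : Interval
      param-interior : Interior param
      other-interior : Interior otherParam
      meet           : curve (arc e) param ≈Pt curve (arc other) otherParam

  -- `otherParam` is determined by the rest since arcs are injective.
  SameCrossing : ∀ {e} → Crossing e → Crossing e → Set
  SameCrossing c d = Crossing.other c ≡ Crossing.other d × Crossing.param c ≈I Crossing.param d

  -- There are no k + 1 pairwise different crossings on e.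
  CrossedAtMost : ℕ → Edge G → Set
  CrossedAtMost k e =
    ¬ (Σ (Fin (suc k) → Crossing e) λ c → ∀ i j → i ≢ j → ¬ SameCrossing (c i) (c j))

KPlanar : ℕ → {n : ℕ} → Graph n → Set
KPlanar k G = Σ (Drawing G) λ D → ∀ e → Drawing.CrossedAtMost D k e

{-# OPTIONS --safe #-}

-- Truncate the hexagonal tiling to get the tiling 3.12.12, and in every 12-gon v₀ … v₁₁
-- (v₀v₁ a side of a triangle) add the six chords joining v₂ᵢ to v₂ᵢ₊₄. Each chord crosses
-- exactly two others, and every vertex has an even index in exactly one of its two 12-gons,
-- so the graph is 5-regular; no two of its vertices have two common neighbours.
-- Rolled up to a cylinder of bounded circumference it loses only O(1) edges when cut to
-- finitely many vertices. The cylinder has a screw motion with six orbits of vertices and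
-- fifteen of edges, and there is a straight-line drawing in the plane in which this motion
-- is multiplication by −1 + i: the vertex of level l in orbit j lies at (−1 + i)ˡ · base j.
-- Dividing by a power of −1 + i, the relative position of two edges depends only on their
-- orbits and on the difference of their levels. Small differences are a finite check with
-- separating lines; for large differences the lower edge is so close to the origin that a
-- fixed line separates it from the upper one.
module Submission where

open import Defs
open import Data.Bool using (false; T; _∨_)
open import Data.Bool.Properties using (∨-comm; T-∨; T-irrelevant)
open import Data.Fin as Fin using (Fin; zero; suc; toℕ; fromℕ<; #_; remQuot; combine)
import Data.Fin.Properties as Fin
open import Data.Integer as ℤ using (ℤ; +_; -[1+_])
import Data.Integer.Properties as ℤ
open import Data.Integer.Tactic.RingSolver using () renaming (solve-∀ to ℤ-solve-∀)
open import Data.List as List using (List; []; _∷_)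
open import Data.List.Membership.Propositional using (_∈_)
open import Data.List.Membership.Propositional.Properties using (∈-filter⁺; ∈-cartesianProduct⁺; ∈-allFin)
open import Data.List.Relation.Unary.Any as Any using (Any)
open import Data.List.Relation.Unary.Any.Properties using (lookup-index)
open import Data.Nat as ℕ using (ℕ; zero; suc; _^_)
open import Data.Nat.Divisibility using (n∣m*n)
open import Data.Nat.DivMod using (_mod_; _divMod_; DivMod; [m+kn]%n≡m%n; m<n⇒m%n≡m; m<n⇒m/n≡0; m*n/n≡m; +-distrib-/-∣ʳ; m/n*n≤m)
import Data.Nat.Properties as ℕ
open import Data.Nat.Tactic.RingSolver using () renaming (solve-∀ to ℕ-solve-∀)
open import Data.Product using (Σ; ∃-syntax; _×_; _,_; proj₁; proj₂)
import Data.Product.Properties as Product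
open import Data.Rational as ℚ using (ℚ; mkℚ; 0ℚ; 1ℚ; ½; _/_; _*_; _+_; _-_; -_; 1/_; ∣_∣; _≤_; _<_; toℚᵘ; positive; nonNegative; ≢-nonZero)
import Data.Rational.Properties as ℚ
open import Data.Rational.Unnormalised as ℚᵘ using (mkℚᵘ; *≡*; *≤*; *<*)
import Data.Rational.Unnormalised.Properties as ℚᵘ
open import Data.Sum as Sum using (_⊎_; inj₁; inj₂; [_,_]′)
import Data.Sum.Properties as Sum
open import Data.Vec using ([]; _∷_; lookup)
open import Function using (_∘_; case_of_)
open import Function.Bundles using (Equivalence)
open import Level using (0ℓ)
open import Relation.Binary.PropositionalEquality
open import Relation.Nullary using (Dec; ¬_; yes; no; ¬?; contradiction)
open import Relation.Nullary.Decidable using (map′; _×-dec_; _⊎-dec_; _→-dec_; toWitness; fromWitness; isYes; isYes≗does; dec-false; dec⇒maybe)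
open import Tactic.RingSolver using (solve-∀)
open import Tactic.RingSolver.Core.AlmostCommutativeRing using (AlmostCommutativeRing; fromCommutativeRing)
open import Algebra.Properties.AbelianGroup ℤ.+-0-abelianGroup using (∙-cancelˡ)

ℚ-ring : AlmostCommutativeRing 0ℓ 0ℓ
ℚ-ring = fromCommutativeRing ℚ.+-*-commutativeRing (λ p → dec⇒maybe (0ℚ ℚ.≟ p))

-- Order on ℚ

p≤q⇒0≤q-p : ∀ {p q} → p ≤ q → 0ℚ ≤ q - p
p≤q⇒0≤q-p {p} {q} p≤q = subst (_≤ q - p) (ℚ.+-inverseʳ p) (ℚ.+-monoˡ-≤ (- p) p≤q)

≤-via : ∀ {p q r} → r ≡ q - p → 0ℚ ≤ r → p ≤ q
≤-via {p} {q} refl 0≤r = subst₂ _≤_ (ℚ.+-identityʳ p) (eq p q) (ℚ.+-monoʳ-≤ p 0≤r)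
  where
  eq : ∀ p q → p + (q - p) ≡ q
  eq = solve-∀ ℚ-ring

p<q⇒0<q-p : ∀ {p q} → p < q → 0ℚ < q - p
p<q⇒0<q-p {p} {q} p<q = subst (_< q - p) (ℚ.+-inverseʳ p) (ℚ.+-monoˡ-< (- p) p<q)

0≤+ : ∀ {p q} → 0ℚ ≤ p → 0ℚ ≤ q → 0ℚ ≤ p + q
0≤+ = ℚ.+-mono-≤

0≤* : ∀ {p q} → 0ℚ ≤ p → 0ℚ ≤ q → 0ℚ ≤ p * q
0≤* {p} {q} 0≤p 0≤q = subst (_≤ p * q) (ℚ.*-zeroʳ p) (ℚ.*-monoˡ-≤-nonNeg p {{nonNegative 0≤p}} 0≤q)

0<* : ∀ {p q} → 0ℚ < p → 0ℚ < q → 0ℚ < p * q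
0<* {p} {q} 0<p 0<q = subst (_< p * q) (ℚ.*-zeroʳ p) (ℚ.*-monoʳ-<-pos p {{positive 0<p}} 0<q)

p≤∣p∣ : ∀ p → p ≤ ∣ p ∣
p≤∣p∣ p with ℚ.≤-total 0ℚ p
... | inj₁ 0≤p = ℚ.≤-reflexive (sym (ℚ.0≤p⇒∣p∣≡p 0≤p))
... | inj₂ p≤0 = ℚ.≤-trans p≤0 (ℚ.0≤∣p∣ p)

∣p∣≤q : ∀ {p q} → p ≤ q → - p ≤ q → ∣ p ∣ ≤ q
∣p∣≤q {p} p≤q -p≤q with ℚ.∣p∣≡p∨∣p∣≡-p p
... | inj₁ eq rewrite eq = p≤q
... | inj₂ eq rewrite eq = -p≤q

∣p-q∣≤r⇒p≤q+r : ∀ {p q r} → ∣ p - q ∣ ≤ r → p ≤ q + r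
∣p-q∣≤r⇒p≤q+r {p} {q} {r} h = ≤-via (eq p q r) (p≤q⇒0≤q-p (ℚ.≤-trans (p≤∣p∣ (p - q)) h))
  where
  eq : ∀ p q r → r - (p - q) ≡ (q + r) - p
  eq = solve-∀ ℚ-ring

∣p-q∣≡∣q-p∣ : ∀ p q → ∣ p - q ∣ ≡ ∣ q - p ∣
∣p-q∣≡∣q-p∣ p q = trans (sym (ℚ.∣-p∣≡∣p∣ (p - q))) (cong ∣_∣ (eq p q))
  where
  eq : ∀ p q → - (p - q) ≡ q - p
  eq = solve-∀ ℚ-ring

∣p-q∣≤r : ∀ {p q r} → p ≤ q + r → q ≤ p + r → ∣ p - q ∣ ≤ r
∣p-q∣≤r {p} {q} {r} h₁ h₂ = ∣p∣≤q
  (≤-via (eq₁ p q r) (p≤q⇒0≤q-p h₁)) (≤-via (eq₂ p q r) (p≤q⇒0≤q-p h₂))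
  where
  eq₁ : ∀ p q r → (q + r) - p ≡ r - (p - q)
  eq₁ = solve-∀ ℚ-ring
  eq₂ : ∀ p q r → (p + r) - q ≡ r - (- (p - q))
  eq₂ = solve-∀ ℚ-ring

-- Integers in ℚ

ι : ℤ → ℚ
ι z = z / 1

private
  toℚᵘ-/ : ∀ n d → toℚᵘ (n / suc d) ℚᵘ.≃ mkℚᵘ n d
  toℚᵘ-/ n d = ℚ.toℚᵘ-fromℚᵘ (mkℚᵘ n d)

ι-homo-+ : ∀ a b → ι (a ℤ.+ b) ≡ ι a + ι b
ι-homo-+ a b = ℚ.toℚᵘ-injective (begin
  toℚᵘ (ι (a ℤ.+ b))           ≈⟨ toℚᵘ-/ (a ℤ.+ b) 0 ⟩
  mkℚᵘ (a ℤ.+ b) 0              ≈⟨ *≡* (eq a b) ⟩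
  mkℚᵘ a 0 ℚᵘ.+ mkℚᵘ b 0        ≈⟨ ℚᵘ.+-cong (toℚᵘ-/ a 0) (toℚᵘ-/ b 0) ⟨
  toℚᵘ (ι a) ℚᵘ.+ toℚᵘ (ι b)    ≈⟨ ℚ.toℚᵘ-homo-+ (ι a) (ι b) ⟨
  toℚᵘ (ι a + ι b)              ∎)
  where
  open ℚᵘ.≃-Reasoning
  eq : ∀ a b → (a ℤ.+ b) ℤ.* ℤ.1ℤ ≡ (a ℤ.* ℤ.1ℤ ℤ.+ b ℤ.* ℤ.1ℤ) ℤ.* ℤ.1ℤ
  eq = ℤ-solve-∀

/-homo-* : ∀ a b c d → (a / suc c) * (b / suc d) ≡ (a ℤ.* b) / (suc c ℕ.* suc d)
/-homo-* a b c d = ℚ.toℚᵘ-injective (begin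
  toℚᵘ (a / suc c * (b / suc d))             ≈⟨ ℚ.toℚᵘ-homo-* (a / suc c) (b / suc d) ⟩
  toℚᵘ (a / suc c) ℚᵘ.* toℚᵘ (b / suc d)     ≈⟨ ℚᵘ.*-cong (toℚᵘ-/ a c) (toℚᵘ-/ b d) ⟩
  mkℚᵘ a c ℚᵘ.* mkℚᵘ b d                     ≈⟨ toℚᵘ-/ (a ℤ.* b) _ ⟨
  toℚᵘ ((a ℤ.* b) / (suc c ℕ.* suc d))       ∎)
  where open ℚᵘ.≃-Reasoning

ι-homo-* : ∀ a b → ι (a ℤ.* b) ≡ ι a * ι b
ι-homo-* a b = sym (/-homo-* a b 0 0)

ι-homo‿- : ∀ a → ι (ℤ.- a) ≡ - ι a
ι-homo‿- a = begin
  ι (ℤ.- a)                    ≡⟨ eq (ι (ℤ.- a)) (ι a) ⟩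
  (ι (ℤ.- a) + ι a) - ι a      ≡⟨ cong (_- ι a) (ι-homo-+ (ℤ.- a) a) ⟨
  ι (ℤ.- a ℤ.+ a) - ι a        ≡⟨ cong (λ z → ι z - ι a) (ℤ.+-inverseˡ a) ⟩
  0ℚ - ι a                     ≡⟨ ℚ.+-identityˡ (- ι a) ⟩
  - ι a                        ∎
  where
  open ≡-Reasoning
  eq : ∀ p q → p ≡ (p + q) - q
  eq = solve-∀ ℚ-ring

ι-homo-sub : ∀ a b → ι (a ℤ.- b) ≡ ι a - ι b
ι-homo-sub a b = trans (ι-homo-+ a (ℤ.- b)) (cong (λ q → ι a + q) (ι-homo‿- b))

ι-mono-≤ : ∀ {a b} → a ℤ.≤ b → ι a ≤ ι b
ι-mono-≤ {a} {b} a≤b = ℚ.toℚᵘ-cancel-≤ (ℚᵘ.≤-respˡ-≃ (ℚᵘ.≃-sym (toℚᵘ-/ a 0))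
  (ℚᵘ.≤-respʳ-≃ (ℚᵘ.≃-sym (toℚᵘ-/ b 0)) (*≤* (ℤ.*-monoʳ-≤-nonNeg ℤ.1ℤ a≤b))))

ι-mono-< : ∀ {a b} → a ℤ.< b → ι a < ι b
ι-mono-< {a} {b} a<b = ℚ.toℚᵘ-cancel-< (ℚᵘ.<-respˡ-≃ (ℚᵘ.≃-sym (toℚᵘ-/ a 0))
  (ℚᵘ.<-respʳ-≃ (ℚᵘ.≃-sym (toℚᵘ-/ b 0)) (*<* (ℤ.*-monoʳ-<-pos ℤ.1ℤ a<b))))

ι-injective : ∀ {a b} → ι a ≡ ι b → a ≡ b
ι-injective {a} {b} eq = subst₂ _≡_ (ℤ.*-identityʳ a) (ℤ.*-identityʳ b)
  (ℚᵘ.drop-*≡* (ℚ.fromℚᵘ-injective {mkℚᵘ a 0} {mkℚᵘ b 0} eq))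

0<inv : ∀ n → 0ℚ < inv n
0<inv n = ℚ.positive⁻¹ (inv n) {{ℚ.normalize-pos 1 (suc n)}}

0≤inv : ∀ n → 0ℚ ≤ inv n
0≤inv n = ℚ.<⇒≤ (0<inv n)

inv-* : ∀ m n → inv m * inv n ≡ inv (n ℕ.+ m ℕ.* suc n)
inv-* m n = /-homo-* (+ 1) (+ 1) m n

suc*inv : ∀ n → ι (+ suc n) * inv n ≡ 1ℚ
suc*inv n = begin
  ι (+ suc n) * inv n                      ≡⟨ /-homo-* (+ suc n) (+ 1) 0 n ⟩
  (+ suc n ℤ.* + 1) / (1 ℕ.* suc n)        ≡⟨ ℚ.fromℚᵘ-cong {mkℚᵘ (+ suc n ℤ.* + 1) (n ℕ.+ 0)} {mkℚᵘ (+ 1) 0} (*≡* cross-multiplied) ⟩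
  + 1 / 1                                  ∎
  where
  open ≡-Reasoning
  cross-multiplied : + suc n ℤ.* + 1 ℤ.* + 1 ≡ + 1 ℤ.* + suc (n ℕ.+ 0)
  cross-multiplied = trans (cong (ℤ._* + 1) (trans (ℤ.*-identityʳ (+ suc n)) (cong (+_ ∘ suc) (sym (ℕ.+-identityʳ n)))))
    (ℤ.*-comm (+ suc (n ℕ.+ 0)) (+ 1))

i≤+∣i∣ : ∀ i → i ℤ.≤ + ℤ.∣ i ∣
i≤+∣i∣ (+ _)    = ℤ.≤-refl
i≤+∣i∣ -[1+ _ ] = ℤ.-≤+

<suc∣↥∣ : ∀ p → p < ι (+ suc ℤ.∣ ℚ.↥ p ∣)
<suc∣↥∣ p@(mkℚ n d _) = ℚ.toℚᵘ-cancel-< (ℚᵘ.<-respʳ-≃ (ℚᵘ.≃-sym (toℚᵘ-/ (+ suc ℤ.∣ n ∣) 0)) (*<* (begin-strict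
  n ℤ.* + 1                    ≡⟨ ℤ.*-identityʳ n ⟩
  n                            ≤⟨ i≤+∣i∣ n ⟩
  + ℤ.∣ n ∣                    <⟨ ℤ.+<+ (ℕ.n<1+n _) ⟩
  + suc ℤ.∣ n ∣                ≤⟨ ℤ.+≤+ (ℕ.m≤m*n (suc ℤ.∣ n ∣) (suc d)) ⟩
  + (suc ℤ.∣ n ∣ ℕ.* suc d)    ≡⟨ ℤ.pos-* (suc ℤ.∣ n ∣) (suc d) ⟩
  + suc ℤ.∣ n ∣ ℤ.* + suc d    ∎)))
  where
  open ℤ.≤-Reasoning

inv≤ : ∀ {p} → 0ℚ < p → ∃[ d ] inv d ≤ p
inv≤ {mkℚ (+ suc n) d _} _ = d , ℚ.toℚᵘ-cancel-≤ (ℚᵘ.≤-respˡ-≃ (ℚᵘ.≃-sym (toℚᵘ-/ (+ 1) d))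
  (*≤* (ℤ.*-monoʳ-≤-nonNeg (+ suc d) {+ 1} {+ suc n} (ℤ.+≤+ (ℕ.s≤s ℕ.z≤n)))))
inv≤ {mkℚ (+ 0) d c} 0<p = contradiction 0<p (λ { (ℚ.*<* (ℤ.+<+ ())) })
inv≤ {mkℚ (ℤ.-[1+ _ ]) d _} 0<p = contradiction 0<p (λ { (ℚ.*<* ()) })

archimedean : ∀ {p q} K → (∀ n → p ≤ q + K * inv n) → p ≤ q
archimedean {p} {q} K bound = ℚ.≮⇒≥ (λ q<p → impossible q<p)
  where
  impossible : ¬ (q < p)
  impossible q<p with inv≤ (p<q⇒0<q-p q<p)
  ... | d , inv-d≤ = ℚ.<-irrefl refl (begin-strict
    p                          ≤⟨ bound n ⟩
    q + K * inv n              ≡⟨ cong (λ r → q + K * r) (inv-* m d) ⟨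
    q + K * (inv m * inv d)    ≡⟨ cong (λ r → q + r) (ℚ.*-assoc K (inv m) (inv d)) ⟨
    q + K * inv m * inv d      <⟨ ℚ.+-monoʳ-< q (ℚ.*-monoˡ-<-pos (inv d) {{positive (0<inv d)}} K*inv<1) ⟩
    q + 1ℚ * inv d             ≡⟨ cong (λ r → q + r) (ℚ.*-identityˡ (inv d)) ⟩
    q + inv d                  ≤⟨ ℚ.+-monoʳ-≤ q inv-d≤ ⟩
    q + (p - q)                ≡⟨ eq p q ⟩
    p                          ∎)
    where
    open ℚ.≤-Reasoning
    -- Since `K < m + 1`, the factor `K * inv m` is below 1. The index `n` satisfies n + 1 = (m +
    -- 1)(d + 1), so `inv n` factors as `inv m * inv d` and the error stays below the gap `p - q`.
    m = ℤ.∣ ℚ.↥ K ∣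
    n = d ℕ.+ m ℕ.* suc d
    K*inv<1 : K * inv m < 1ℚ
    K*inv<1 = subst (K * inv m <_) (suc*inv m)
      (ℚ.*-monoˡ-<-pos (inv m) {{positive (0<inv m)}} (<suc∣↥∣ K))
    eq : ∀ p q → q + (p - q) ≡ p
    eq = solve-∀ ℚ-ring

-- Sequences of rationals up to O(1/n)

infix 4 _≲_ _∼_

-- Leaving the constant free makes the relation closed under sums and scaling, so linear identities
-- can be applied term by term; the fixed tolerance of `_≈ℝ_` does not allow this. `≈⇒∼` and `∼⇒≈`
-- translate.
record _≲_ (x y : ℕ → ℚ) : Set where
  constructor _,_
  field
    constant : ℚ
    bound    : ∀ n → x n ≤ y n + constant * inv n

record _∼_ (x y : ℕ → ℚ) : Set where
  constructor _,_
  field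
    ≲-part : x ≲ y
    ≳-part : y ≲ x

private variable
  x y z x′ y′ : ℕ → ℚ

≲-reflexive : (∀ n → x n ≡ y n) → x ≲ y
≲-reflexive {x} {y} x≡y = 0ℚ , λ n → ℚ.≤-reflexive (trans (x≡y n) (eq (y n) (inv n)))
  where
  eq : ∀ p i → p ≡ p + 0ℚ * i
  eq = solve-∀ ℚ-ring

≲-trans : x ≲ y → y ≲ z → x ≲ z
≲-trans {x} {y} {z} (K , h) (L , k) = K + L , λ n →
  ≤-via (eq (x n) (y n) (z n) K L (inv n)) (0≤+ (p≤q⇒0≤q-p (h n)) (p≤q⇒0≤q-p (k n)))
  where
  eq : ∀ x y z K L i → ((y + K * i) - x) + ((z + L * i) - y) ≡ (z + (K + L) * i) - x
  eq = solve-∀ ℚ-ring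

≲-+ : x ≲ y → x′ ≲ y′ → (λ n → x n + x′ n) ≲ (λ n → y n + y′ n)
≲-+ {x} {y} {x′} {y′} (K , h) (L , k) = K + L , λ n →
  ≤-via (eq (x n) (y n) (x′ n) (y′ n) K L (inv n)) (0≤+ (p≤q⇒0≤q-p (h n)) (p≤q⇒0≤q-p (k n)))
  where
  eq : ∀ x y x′ y′ K L i → ((y + K * i) - x) + ((y′ + L * i) - x′) ≡ ((y + y′) + (K + L) * i) - (x + x′)
  eq = solve-∀ ℚ-ring

≲-scale : ∀ {c} → 0ℚ ≤ c → x ≲ y → (λ n → c * x n) ≲ (λ n → c * y n)
≲-scale {x} {y} {c} 0≤c (K , h) = c * K , λ n →
  ≤-via (eq c (x n) (y n) K (inv n)) (0≤* 0≤c (p≤q⇒0≤q-p (h n)))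
  where
  eq : ∀ c x y K i → c * ((y + K * i) - x) ≡ (c * y + (c * K) * i) - c * x
  eq = solve-∀ ℚ-ring

≲-neg : x ≲ y → (λ n → - y n) ≲ (λ n → - x n)
≲-neg {x} {y} (K , h) = K , λ n → ≤-via (eq (x n) (y n) K (inv n)) (p≤q⇒0≤q-p (h n))
  where
  eq : ∀ x y K i → (y + K * i) - x ≡ (- x + K * i) - (- y)
  eq = solve-∀ ℚ-ring

≲-const : ∀ {p q} → (λ _ → p) ≲ (λ _ → q) → p ≤ q
≲-const (K , h) = archimedean K h

∼-reflexive : (∀ n → x n ≡ y n) → x ∼ y
∼-reflexive x≡y = ≲-reflexive x≡y , ≲-reflexive (sym ∘ x≡y)

∼-sym : x ∼ y → y ∼ x
∼-sym (h , k) = k , h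

∼-trans : x ∼ y → y ∼ z → x ∼ z
∼-trans (h , h′) (k , k′) = ≲-trans h k , ≲-trans k′ h′

∼-+ : x ∼ y → x′ ∼ y′ → (λ n → x n + x′ n) ∼ (λ n → y n + y′ n)
∼-+ (h , h′) (k , k′) = ≲-+ h k , ≲-+ h′ k′

∼-scale : ∀ c → x ∼ y → (λ n → c * x n) ∼ (λ n → c * y n)
∼-scale c (h , h′) with ℚ.≤-total 0ℚ c
... | inj₁ 0≤c = ≲-scale 0≤c h , ≲-scale 0≤c h′
... | inj₂ c≤0 = flip h′ , flip h
  where
  eq : ∀ c p → c * p ≡ (- c) * (- p)
  eq = solve-∀ ℚ-ring
  flip : y ≲ x → (λ n → c * x n) ≲ (λ n → c * y n)
  flip {y} {x} h = ≲-trans (≲-reflexive (λ n → eq c (x n)))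
    (≲-trans (≲-scale (ℚ.neg-antimono-≤ c≤0) (≲-neg h)) (≲-reflexive (λ n → sym (eq c (y n)))))

≈⇒∼ : ∀ {a b} → a ≈ℝ b → approx a ∼ approx b
≈⇒∼ {a} {b} a≈b = (1ℚ + 1ℚ , λ n → one-sided n (a≈b n))
  , (1ℚ + 1ℚ , λ n → one-sided n (subst (_≤ _) (∣p-q∣≡∣q-p∣ (approx a n) (approx b n)) (a≈b n)))
  where
  eq : ∀ i → 0ℚ + (i + i) ≡ (1ℚ + 1ℚ) * i
  eq = solve-∀ ℚ-ring
  one-sided : ∀ {p q} n → ∣ p - q ∣ ≤ 0ℚ + (inv n + inv n) → p ≤ q + (1ℚ + 1ℚ) * inv n
  one-sided {p} {q} n h = ∣p-q∣≤r⇒p≤q+r (subst (∣ p - q ∣ ≤_) (eq (inv n)) h)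

approx-≤ : ∀ a m n → approx a m ≤ approx a n + (inv m + inv n)
approx-≤ a m n = ∣p-q∣≤r⇒p≤q+r {approx a m} {approx a n} (regular a m n)

-- The comparison is made at an index `m` far beyond `n`, where the constant no longer matters.
-- Regularity of `a` and of `b` moves between `m` and `n` at a cost of `inv n + inv m` each, and
-- `archimedean` removes the terms in `inv m`.
∼⇒≈ : ∀ {a b} → approx a ∼ approx b → a ≈ℝ b
∼⇒≈ {a} {b} (h , h′) n = ∣p-q∣≤r (one-sided {a} {b} h) (one-sided {b} {a} h′)
  where
  eq : ∀ a a′ b b′ K i j → ((a′ + (i + j)) - a) + ((b′ + K * j) - a′) + ((b + (j + i)) - b′)
     ≡ (b + (0ℚ + (i + i)) + (1ℚ + 1ℚ + K) * j) - a
  eq = solve-∀ ℚ-ring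
  one-sided : ∀ {a b} → approx a ≲ approx b → approx a n ≤ approx b n + (0ℚ + (inv n + inv n))
  one-sided {a} {b} (K , h) = archimedean (1ℚ + 1ℚ + K) λ m →
    ≤-via (eq (approx a n) (approx a m) (approx b n) (approx b m) K (inv n) (inv m))
      (0≤+ (0≤+ (p≤q⇒0≤q-p (approx-≤ a n m)) (p≤q⇒0≤q-p (h m)))
           (p≤q⇒0≤q-p (approx-≤ b m n)))

-- Affine functions of a real variable

∣ι∣*inv≤1 : ∀ {a A} → ℤ.∣ a ∣ ℕ.≤ A → ∣ ι a ∣ * inv A ≤ 1ℚ
∣ι∣*inv≤1 {a} {A} ∣a∣≤A = subst (∣ ι a ∣ * inv A ≤_) (suc*inv A)
  (ℚ.*-monoʳ-≤-nonNeg (inv A) {{nonNegative (0≤inv A)}} (∣p∣≤q (ι-mono-≤ (a≤ a ∣a∣≤A))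
    (subst (_≤ _) (ι-homo‿- a) (ι-mono-≤ (a≤ (ℤ.- a) (subst (ℕ._≤ A) (sym (ℤ.∣-i∣≡∣i∣ a)) ∣a∣≤A))))))
  where
  a≤ : ∀ a → ℤ.∣ a ∣ ℕ.≤ A → a ℤ.≤ + suc A
  a≤ (+ n)        n≤A = ℤ.+≤+ (ℕ.m≤n⇒m≤1+n n≤A)
  a≤ (ℤ.-[1+ n ]) _   = ℤ.-≤+

-- An index whose successor is (∣a∣ + 1)(n + 1): an error of `inv` at this index, multiplied by `a`,
-- is at most `inv n`.
refine : ℤ → ℕ → ℕ
refine a n = n ℕ.+ ℤ.∣ a ∣ ℕ.* suc n

∣ι∣*inv-refine≤inv : ∀ a n → ∣ ι a ∣ * inv (refine a n) ≤ inv n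
∣ι∣*inv-refine≤inv a n = begin
  ∣ ι a ∣ * inv (refine a n)           ≡⟨ cong (∣ ι a ∣ *_) (inv-* ℤ.∣ a ∣ n) ⟨
  ∣ ι a ∣ * (inv ℤ.∣ a ∣ * inv n)      ≡⟨ ℚ.*-assoc ∣ ι a ∣ (inv ℤ.∣ a ∣) (inv n) ⟨
  ∣ ι a ∣ * inv ℤ.∣ a ∣ * inv n        ≤⟨ ℚ.*-monoʳ-≤-nonNeg (inv n) {{nonNegative (0≤inv n)}} (∣ι∣*inv≤1 {a} ℕ.≤-refl) ⟩
  1ℚ * inv n                           ≡⟨ ℚ.*-identityˡ (inv n) ⟩
  inv n                                ∎
  where open ℚ.≤-Reasoning

affine-lipschitz : ∀ a b {p q δ} m n → ∣ p - q ∣ ≤ δ + (inv (refine a m) + inv (refine a n)) →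
  ∣ (ι b + ι a * p) - (ι b + ι a * q) ∣ ≤ ∣ ι a ∣ * δ + (inv m + inv n)
affine-lipschitz a b {p} {q} {δ} m n h = begin
  ∣ (ι b + ι a * p) - (ι b + ι a * q) ∣     ≡⟨ cong ∣_∣ (eq₁ (ι a) (ι b) p q) ⟩
  ∣ ι a * (p - q) ∣                         ≡⟨ ℚ.∣p*q∣≡∣p∣*∣q∣ (ι a) (p - q) ⟩
  ∣ ι a ∣ * ∣ p - q ∣                       ≤⟨ ℚ.*-monoˡ-≤-nonNeg ∣ ι a ∣ {{ℚ.∣-∣-nonNeg (ι a)}} h ⟩
  ∣ ι a ∣ * (δ + (inv m′ + inv n′))         ≡⟨ eq₂ ∣ ι a ∣ δ (inv m′) (inv n′) ⟩
  ∣ ι a ∣ * δ + (∣ ι a ∣ * inv m′ + ∣ ι a ∣ * inv n′)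
                                            ≤⟨ ℚ.+-monoʳ-≤ (∣ ι a ∣ * δ) (ℚ.+-mono-≤ (∣ι∣*inv-refine≤inv a m) (∣ι∣*inv-refine≤inv a n)) ⟩
  ∣ ι a ∣ * δ + (inv m + inv n)             ∎
  where
  open ℚ.≤-Reasoning
  m′ = refine a m
  n′ = refine a n
  eq₁ : ∀ a b p q → (b + a * p) - (b + a * q) ≡ a * (p - q)
  eq₁ = solve-∀ ℚ-ring
  eq₂ : ∀ a δ i j → a * (δ + (i + j)) ≡ a * δ + (a * i + a * j)
  eq₂ = solve-∀ ℚ-ring

affine : ℤ → ℤ → ℝ → ℝ
affine a b s .approx n    = ι b + ι a * approx s (refine a n)
affine a b s .regular m n = ℚ.≤-trans
  (affine-lipschitz a b {approx s (refine a m)} {approx s (refine a n)} m n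
    (ℚ.≤-trans (regular s (refine a m) (refine a n)) (ℚ.≤-reflexive (sym (ℚ.+-identityˡ _)))))
  (ℚ.≤-reflexive (eq ∣ ι a ∣ (inv m + inv n)))
  where
  eq : ∀ a i → a * 0ℚ + i ≡ i
  eq = solve-∀ ℚ-ring

affine-continuous : ∀ {a A} b {ε s t} → ℤ.∣ a ∣ ℕ.≤ A → 0ℚ ≤ ε →
  Within (ε * inv A) s t → Within ε (affine a b s) (affine a b t)
affine-continuous {a} {A} b {ε} ∣a∣≤A 0≤ε h n =
  ℚ.≤-trans (affine-lipschitz a b n n (h (refine a n))) (ℚ.+-monoˡ-≤ (inv n + inv n) (begin
    ∣ ι a ∣ * (ε * inv A)    ≡⟨ eq ∣ ι a ∣ ε (inv A) ⟩
    ε * (∣ ι a ∣ * inv A)    ≤⟨ ℚ.*-monoˡ-≤-nonNeg ε {{nonNegative 0≤ε}} (∣ι∣*inv≤1 {a} ∣a∣≤A) ⟩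
    ε * 1ℚ                   ≡⟨ ℚ.*-identityʳ ε ⟩
    ε                        ∎))
  where
  open ℚ.≤-Reasoning
  eq : ∀ a e i → a * (e * i) ≡ e * (a * i)
  eq = solve-∀ ℚ-ring

-- Moving from the refined index to `n` changes a regular sequence by at most
-- `inv (refine a n) + inv n`, hence by at most twice `inv n`; up to `∼` the resampling in `affine`
-- can be forgotten.
affine-∼ : ∀ a b s → approx (affine a b s) ∼ (λ n → ι b + ι a * approx s n)
affine-∼ a b s = ∼-+ {λ _ → ι b} (∼-reflexive (λ _ → refl)) (∼-scale (ι a) (resample , resample′))
  where
  eq : ∀ p q i j → ((q + (i + j)) - p) + (j - i) ≡ (q + (1ℚ + 1ℚ) * j) - p
  eq = solve-∀ ℚ-ring
  inv-refine≤inv : ∀ n → inv (refine a n) ≤ inv n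
  inv-refine≤inv n = subst₂ _≤_ (inv-* ℤ.∣ a ∣ n) (ℚ.*-identityˡ (inv n))
    (ℚ.*-monoʳ-≤-nonNeg (inv n) {{nonNegative (0≤inv n)}} (inv≤1 ℤ.∣ a ∣))
    where
    inv≤1 : ∀ m → inv m ≤ 1ℚ
    inv≤1 m = subst₂ _≤_ (ℚ.*-identityˡ (inv m)) (suc*inv m)
      (ℚ.*-monoʳ-≤-nonNeg (inv m) {{nonNegative (0≤inv m)}} (ι-mono-≤ {+ 1} {+ suc m} (ℤ.+≤+ (ℕ.s≤s ℕ.z≤n))))
  resample : (λ n → approx s (refine a n)) ≲ approx s
  resample = (1ℚ + 1ℚ) , λ n → ≤-via (eq (approx s (refine a n)) (approx s n) (inv (refine a n)) (inv n))
    (0≤+ (p≤q⇒0≤q-p (approx-≤ s (refine a n) n)) (p≤q⇒0≤q-p (inv-refine≤inv n)))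
  eq′ : ∀ p q i j → ((q + (j + i)) - p) + (j - i) ≡ (q + (1ℚ + 1ℚ) * j) - p
  eq′ = solve-∀ ℚ-ring
  resample′ : approx s ≲ (λ n → approx s (refine a n))
  resample′ = (1ℚ + 1ℚ) , λ n → ≤-via (eq′ (approx s n) (approx s (refine a n)) (inv (refine a n)) (inv n))
    (0≤+ (p≤q⇒0≤q-p (approx-≤ s n (refine a n))) (p≤q⇒0≤q-p (inv-refine≤inv n)))

-- Segments between integer points

ℤ² : Set
ℤ² = ℤ × ℤ

det : ℤ² → ℤ² → ℤ
det (a , b) (c , d) = a ℤ.* d ℤ.- b ℤ.* c

toPoint : ℤ² → Point
toPoint (a , b) = point (fromℚ (ι a)) (fromℚ (ι b))

segment : ℤ² → ℤ² → Interval → Point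
segment (a , b) (c , d) s = point (affine (c ℤ.- a) a (value s)) (affine (d ℤ.- b) b (value s))

-- The linear form `det w` extended from integer points to real ones. Its level sets are the lines
-- of direction `w`; they serve as separating lines.
det-with : ℤ² → Point → ℕ → ℚ
det-with (a , b) P n = ι a * approx (y-coord P) n + (- ι b) * approx (x-coord P) n

det-with-cong : ∀ w {P Q} → P ≈Pt Q → det-with w P ∼ det-with w Q
det-with-cong (a , b) {P} {Q} (x≈ , y≈) =
  ∼-+ (∼-scale (ι a) (≈⇒∼ {y-coord P} {y-coord Q} y≈)) (∼-scale (- ι b) (≈⇒∼ {x-coord P} {x-coord Q} x≈))

ι-det : ∀ a b c d → ι (det (a , b) (c , d)) ≡ ι a * ι d - ι b * ι c
ι-det a b c d = trans (ι-homo-sub (a ℤ.* d) (b ℤ.* c)) (cong₂ _-_ (ι-homo-* a d) (ι-homo-* b c))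

-- Linear forms on segments: separation and transversality

lerp : ℚ → ℚ → (ℕ → ℚ) → ℕ → ℚ
lerp p q s n = p + (q - p) * s n

det-with-segment : ∀ w u v s → det-with w (segment u v s) ∼ lerp (ι (det w u)) (ι (det w v)) (approx (value s))
det-with-segment (a , b) (c , d) (e , f) s = ∼-trans
  (∼-+ (∼-scale (ι a) (affine-∼ (f ℤ.- d) d (value s))) (∼-scale (- ι b) (affine-∼ (e ℤ.- c) c (value s))))
  (∼-reflexive (λ n → pointwise (approx (value s) n) (ι-homo-sub f d) (ι-homo-sub e c) (ι-det a b c d) (ι-det a b e f)))
  where
  eq : ∀ a b c d e f s → a * (d + (f - d) * s) + (- b) * (c + (e - c) * s)
    ≡ (a * d - b * c) + ((a * f - b * e) - (a * d - b * c)) * s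
  eq = solve-∀ ℚ-ring
  pointwise : ∀ s {F E U V} → F ≡ ι f - ι d → E ≡ ι e - ι c →
    U ≡ ι a * ι d - ι b * ι c → V ≡ ι a * ι f - ι b * ι e →
    ι a * (ι d + F * s) + (- ι b) * (ι c + E * s) ≡ U + (V - U) * s
  pointwise s refl refl refl refl = eq (ι a) (ι b) (ι c) (ι d) (ι e) (ι f) s

-- Rational margins by which a parameter stays away from 0 and from 1; they become the weights of
-- the two ends in `lerp-lower`.
record Inner (S : ℕ → ℚ) : Set where
  field
    {η θ}  : ℚ
    0<η    : 0ℚ < η
    0<θ    : 0ℚ < θ
    η≲S    : (λ _ → η) ≲ S
    θ≲1-S  : (λ _ → θ) ≲ (λ n → 1ℚ - S n)

interior⇒inner : ∀ {s} → Interior s → Inner (approx (value s))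
interior⇒inner {s} ((l , 0<s) , (m , s<1)) = record
  { 0<η   = 0<inv l
  ; 0<θ   = 0<inv m
  -- The witness of `0 < s` at index `l` leaves room for twice `inv l`; regularity uses up one of
  -- these, and the other is the margin. The bound for `1 - s` is symmetric.
  ; η≲S   = 1ℚ , λ n → ≤-via (eq₁ (S l) (S n) (inv l) (inv n))
      (0≤+ (p≤q⇒0≤q-p (ℚ.<⇒≤ 0<s)) (p≤q⇒0≤q-p (approx-≤ (value s) l n)))
  ; θ≲1-S = 1ℚ , λ n → ≤-via (eq₂ (S m) (S n) (inv m) (inv n))
      (0≤+ (p≤q⇒0≤q-p (ℚ.<⇒≤ s<1)) (p≤q⇒0≤q-p (approx-≤ (value s) n m)))
  }
  where
  S : ℕ → ℚ
  S = approx (value s)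
  eq₁ : ∀ p q i j → (p - (0ℚ + (i + i))) + ((q + (i + j)) - p) ≡ (q + 1ℚ * j) - i
  eq₁ = solve-∀ ℚ-ring
  eq₂ : ∀ p q i j → (1ℚ - (p + (i + i))) + ((p + (j + i)) - q) ≡ ((1ℚ - q) + 1ℚ * j) - i
  eq₂ = solve-∀ ℚ-ring

lerp-lower : ∀ {S : ℕ → ℚ} {η θ p q} → 0ℚ ≤ p → 0ℚ ≤ q → (λ _ → η) ≲ S → (λ _ → θ) ≲ (λ n → 1ℚ - S n) →
  (λ _ → p * θ + q * η) ≲ lerp p q S
lerp-lower {S} {η} {θ} {p} {q} 0≤p 0≤q η≲S θ≲1-S =
  ≲-trans {y = λ n → p * (1ℚ - S n) + q * S n} combined (≲-reflexive (λ n → eq p q (S n)))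
  where
  eq : ∀ p q s → p * (1ℚ - s) + q * s ≡ p + (q - p) * s
  eq = solve-∀ ℚ-ring
  combined : (λ _ → p * θ + q * η) ≲ (λ n → p * (1ℚ - S n) + q * S n)
  combined = ≲-+ {x = λ _ → p * θ} {y = λ n → p * (1ℚ - S n)} {x′ = λ _ → q * η} {y′ = λ n → q * S n}
    (≲-scale 0≤p θ≲1-S) (≲-scale 0≤q η≲S)

0<+ : ∀ p q → 0ℚ < p + q → 0ℚ < p ⊎ 0ℚ < q
0<+ p q 0<p+q with 0ℚ ℚ.<? p
... | yes 0<p = inj₁ 0<p
... | no  0≮p = inj₂ (ℚ.<-≤-trans 0<p+q (subst (p + q ≤_) (ℚ.+-identityˡ q) (ℚ.+-monoˡ-≤ q (ℚ.≮⇒≥ 0≮p))))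

positive-combination : ∀ {p q η θ} → 0ℚ ≤ p → 0ℚ ≤ q → 0ℚ < p + q → 0ℚ < η → 0ℚ < θ → 0ℚ < p * θ + q * η
positive-combination {p} {q} {η} {θ} 0≤p 0≤q 0<p+q 0<η 0<θ =
  [ (λ 0<p → ℚ.+-mono-<-≤ {0ℚ} {p * θ} {0ℚ} {q * η} (0<* 0<p 0<θ) (0≤* 0≤q (ℚ.<⇒≤ 0<η)))
  , (λ 0<q → ℚ.+-mono-≤-< {0ℚ} {p * θ} {0ℚ} {q * η} (0≤* 0≤p (ℚ.<⇒≤ 0<θ)) (0<* 0<q 0<η)) ]′
  (0<+ p q 0<p+q)

-- The difference of the two interpolations is a combination of the four gaps `U - C`, `V - C`,
-- `C - X`, `C - Y` with weights bounded below by the positive margins. The gaps are nonnegative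
-- with positive sum, so one of them is positive and the difference stays above a positive constant.
lerp-separated : ∀ {S T U V X Y C} → C ≤ U → C ≤ V → X ≤ C → Y ≤ C → X + Y < U + V →
  Inner S → Inner T → ¬ (lerp U V S ≲ lerp X Y T)
lerp-separated {S} {T} {U} {V} {X} {Y} {C} C≤U C≤V X≤C Y≤C X+Y<U+V S-inner T-inner meet =
  ℚ.<-irrefl refl (ℚ.<-≤-trans 0<r+r′ r+r′≤0)
  where
  module S = Inner S-inner
  module T = Inner T-inner
  0≤U-C = p≤q⇒0≤q-p C≤U
  0≤V-C = p≤q⇒0≤q-p C≤V
  0≤C-X = p≤q⇒0≤q-p X≤C
  0≤C-Y = p≤q⇒0≤q-p Y≤C
  r r′ : ℚ
  r  = (U - C) * S.θ + (V - C) * S.η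
  r′ = (C - X) * T.θ + (C - Y) * T.η
  sum difference : ℕ → ℚ
  sum n        = lerp (U - C) (V - C) S n + lerp (C - X) (C - Y) T n
  difference n = lerp U V S n + (- lerp X Y T n)
  eq : ∀ U V X Y C s t → ((U - C) + ((V - C) - (U - C)) * s) + ((C - X) + ((C - Y) - (C - X)) * t)
    ≡ (U + (V - U) * s) + (- (X + (Y - X) * t))
  eq = solve-∀ ℚ-ring
  r+r′≲sum : (λ _ → r + r′) ≲ sum
  r+r′≲sum = ≲-+ {x = λ _ → r} {x′ = λ _ → r′}
    (lerp-lower 0≤U-C 0≤V-C S.η≲S S.θ≲1-S) (lerp-lower 0≤C-X 0≤C-Y T.η≲S T.θ≲1-S)
  difference≲0 : difference ≲ (λ _ → 0ℚ)
  difference≲0 = ≲-trans {y = λ n → lerp X Y T n + (- lerp X Y T n)}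
    (≲-+ {x = lerp U V S} {y = lerp X Y T} {x′ = λ n → - lerp X Y T n} meet (≲-reflexive (λ _ → refl)))
    (≲-reflexive (λ n → ℚ.+-inverseʳ (lerp X Y T n)))
  r+r′≤0 : r + r′ ≤ 0ℚ
  r+r′≤0 = ≲-const (≲-trans r+r′≲sum
    (≲-trans {y = difference} (≲-reflexive (λ n → eq U V X Y C (S n) (T n))) difference≲0))
  split : ∀ U V X Y C → (U + V) - (X + Y) ≡ ((U - C) + (V - C)) + ((C - X) + (C - Y))
  split = solve-∀ ℚ-ring
  0<sum : 0ℚ < ((U - C) + (V - C)) + ((C - X) + (C - Y))
  0<sum = subst (0ℚ <_) (split U V X Y C) (p<q⇒0<q-p X+Y<U+V)
  0≤r  = 0≤+ (0≤* 0≤U-C (ℚ.<⇒≤ S.0<θ)) (0≤* 0≤V-C (ℚ.<⇒≤ S.0<η))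
  0≤r′ = 0≤+ (0≤* 0≤C-X (ℚ.<⇒≤ T.0<θ)) (0≤* 0≤C-Y (ℚ.<⇒≤ T.0<η))
  0<r+r′ : 0ℚ < r + r′
  0<r+r′ = [ (λ 0<p → ℚ.+-mono-<-≤ {0ℚ} {r} {0ℚ} {r′} (positive-combination 0≤U-C 0≤V-C 0<p S.0<η S.0<θ) 0≤r′)
           , (λ 0<q → ℚ.+-mono-≤-< {0ℚ} {r} {0ℚ} {r′} 0≤r (positive-combination 0≤C-X 0≤C-Y 0<q T.0<η T.0<θ)) ]′
           (0<+ ((U - C) + (V - C)) ((C - X) + (C - Y)) 0<sum)

-- Ends may lie on the separating line, so edges with a common end can also be separated; `strict`
-- only rules out that all four ends lie on it. Common interior points are then impossible.
record Separated (w : ℤ²) (c : ℤ) (u v x y : ℤ²) : Set where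
  constructor separated
  field
    c≤u    : c ℤ.≤ det w u
    c≤v    : c ℤ.≤ det w v
    x≤c    : det w x ℤ.≤ c
    y≤c    : det w y ℤ.≤ c
    strict : det w x ℤ.+ det w y ℤ.< det w u ℤ.+ det w v

separated⇒¬meet : ∀ {w c u v x y s t} → Separated w c u v x y → Interior s → Interior t →
  ¬ (segment u v s ≈Pt segment x y t)
separated⇒¬meet {w} {c} {u} {v} {x} {y} {s} {t} (separated c≤u c≤v x≤c y≤c strict) s-int t-int meet =
  lerp-separated (ι-mono-≤ c≤u) (ι-mono-≤ c≤v) (ι-mono-≤ x≤c) (ι-mono-≤ y≤c)
    (subst₂ _<_ (ι-homo-+ (det w x) (det w y)) (ι-homo-+ (det w u) (det w v)) (ι-mono-< strict))
    (interior⇒inner {s} s-int) (interior⇒inner {t} t-int)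
    (_∼_.≲-part (∼-trans (∼-sym (det-with-segment w u v s))
      (∼-trans (det-with-cong w {segment u v s} {segment x y t} meet) (det-with-segment w x y t))))

lerp-injective : ∀ {p q} → p ≢ q → ∀ s t → lerp p q (approx s) ∼ lerp p q (approx t) → s ≈ℝ t
lerp-injective {p} {q} p≢q s t h = ∼⇒≈ {s} {t} (∼-trans (∼-sym (unlerp s))
  (∼-trans (∼-scale (1/ (q - p)) (∼-+ h (∼-reflexive {λ _ → - p} (λ _ → refl)))) (unlerp t)))
  where
  q-p≢0 : q - p ≢ 0ℚ
  q-p≢0 eq = p≢q (sym (trans (sym (q-p+p q p)) (trans (cong (λ r → r + p) eq) (ℚ.+-identityˡ p))))
    where
    q-p+p : ∀ q p → (q - p) + p ≡ q
    q-p+p = solve-∀ ℚ-ring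
  instance
    _ = ≢-nonZero q-p≢0
  eq : ∀ i p d s → i * ((p + d * s) + (- p)) ≡ (i * d) * s
  eq = solve-∀ ℚ-ring
  unlerp : ∀ s → (λ n → 1/ (q - p) * (lerp p q (approx s) n + (- p))) ∼ approx s
  unlerp s = ∼-reflexive (λ n → trans (eq (1/ (q - p)) p (q - p) (approx s n))
    (trans (cong (_* approx s n) (ℚ.*-inverseˡ (q - p))) (ℚ.*-identityˡ (approx s n))))

segment-injective : ∀ {w u v} → det w u ≢ det w v → ∀ {s t} → segment u v s ≈Pt segment u v t → s ≈I t
segment-injective {w} {u} {v} u≢v {s} {t} h = lerp-injective (u≢v ∘ ι-injective) (value s) (value t)
  (∼-trans (∼-sym (det-with-segment w u v s))
    (∼-trans (det-with-cong w {segment u v s} {segment u v t} h) (det-with-segment w u v t)))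

-- With `w` the direction of `x y`, the form `det w` has one value on that segment and takes it at
-- most once along `u v`. Thus a common point has a determined parameter on `u v`.
record Transverse (w u v x y : ℤ²) : Set where
  constructor transverse
  field
    constant-on-xy : det w x ≡ det w y
    varies-on-uv   : det w u ≢ det w v

transverse⇒unique : ∀ {w u v x y} → Transverse w u v x y → ∀ {s t s′ t′} →
  segment u v s ≈Pt segment x y s′ → segment u v t ≈Pt segment x y t′ → s ≈I t
transverse⇒unique {w} {u} {v} {x} {y} (transverse x≡y u≢v) {s} {t} {s′} {t′} h h′ =
  lerp-injective (u≢v ∘ ι-injective) (value s) (value t) (∼-trans (on-xy s s′ h) (∼-sym (on-xy t t′ h′)))
  where
  eq : ∀ p s → p + (p - p) * s ≡ p
  eq = solve-∀ ℚ-ring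
  on-xy : ∀ s s′ → segment u v s ≈Pt segment x y s′ → lerp (ι (det w u)) (ι (det w v)) (approx (value s)) ∼ (λ _ → ι (det w x))
  on-xy s s′ h = ∼-trans (∼-sym (det-with-segment w u v s))
    (∼-trans (det-with-cong w {segment u v s} {segment x y s′} h)
    (∼-trans (det-with-segment w x y s′)
      (∼-reflexive (λ n → trans (cong (λ d → ι (det w x) + (ι d - ι (det w x)) * approx (value s′) n) (sym x≡y))
                                (eq (ι (det w x)) (approx (value s′) n))))))

-- Segments as arcs

segment-continuous : ∀ u v ε → 0ℚ < ε → ∃[ δ ] (0ℚ < δ ×
  (∀ s t → Within δ (value s) (value t) → WithinPt ε (segment u v s) (segment u v t)))
segment-continuous (a , b) (c , d) ε 0<ε = ε * inv A , 0<* 0<ε (0<inv A) , λ s t h →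
    affine-continuous {c ℤ.- a} a {s = value s} {t = value t} (ℕ.m≤m+n _ _) (ℚ.<⇒≤ 0<ε) h
  , affine-continuous {d ℤ.- b} b {s = value s} {t = value t} (ℕ.m≤n+m _ ℤ.∣ c ℤ.- a ∣) (ℚ.<⇒≤ 0<ε) h
  where
  -- The sum bounds the slopes of both coordinates, so one δ serves for both.
  A : ℕ
  A = ℤ.∣ c ℤ.- a ∣ ℕ.+ ℤ.∣ d ℤ.- b ∣

segment-source : ∀ u v → segment u v 0I ≈Pt toPoint u
segment-source (a , b) (c , d) = at a c , at b d
  where
  eq : ∀ a d → a + d * 0ℚ ≡ a
  eq = solve-∀ ℚ-ring
  at : ∀ a c → affine (c ℤ.- a) a 0ℝ ≈ℝ fromℚ (ι a)
  at a c = ∼⇒≈ {affine (c ℤ.- a) a 0ℝ} {fromℚ (ι a)} (∼-reflexive (λ _ → eq (ι a) (ι (c ℤ.- a))))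

segment-target : ∀ u v → segment u v 1I ≈Pt toPoint v
segment-target (a , b) (c , d) = at a c , at b d
  where
  eq : ∀ a c → a + (c - a) * 1ℚ ≡ c
  eq = solve-∀ ℚ-ring
  at : ∀ a c → affine (c ℤ.- a) a 1ℝ ≈ℝ fromℚ (ι c)
  at a c = ∼⇒≈ {affine (c ℤ.- a) a 1ℝ} {fromℚ (ι c)} (∼-reflexive (λ _ →
    trans (cong (λ d → ι a + d * 1ℚ) (ι-homo-sub c a)) (eq (ι a) (ι c))))

-- A linear form with different values at the ends witnesses that the ends differ and recovers the
-- parameter, which gives injectivity.
segment-arc : ∀ {w u v} → det w u ≢ det w v → Arc (toPoint u) (toPoint v)
segment-arc {w} {u} {v} u≢v = record
  { curve      = segment u v
  ; continuous = segment-continuous u v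
  ; injective  = λ {s} {t} → segment-injective {w} u≢v {s} {t}
  ; source     = segment-source u v
  ; target     = segment-target u v
  }

½I : Interval
½I = record
  { value = fromℚ ½
  ; lower = fromℚ-mono-≤ (toWitness {a? = 0ℚ ℚ.≤? ½} _)
  ; upper = fromℚ-mono-≤ (toWitness {a? = ½ ℚ.≤? 1ℚ} _)
  }

½I-interior : Interior ½I
-- Index 4 leaves enough room: `inv 4 + inv 4` is 2/5, less than ½.
½I-interior = (4 , toWitness {a? = 0ℚ + (inv 4 + inv 4) ℚ.<? ½} _) , (4 , toWitness {a? = ½ + (inv 4 + inv 4) ℚ.<? 1ℚ} _)

-- Vertices are handled as degenerate segments.
toPoint≈segment : ∀ u → toPoint u ≈Pt segment u u ½I
toPoint≈segment (a , b) = at a , at b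
  where
  eq : ∀ a p → a ≡ a + (a - a) * p
  eq = solve-∀ ℚ-ring
  at : ∀ a → fromℚ (ι a) ≈ℝ affine (a ℤ.- a) a (fromℚ ½)
  at a = ∼⇒≈ {fromℚ (ι a)} {affine (a ℤ.- a) a (fromℚ ½)} (∼-reflexive (λ _ →
    trans (eq (ι a) ½) (cong (λ d → ι a + d * ½) (sym (ι-homo-sub a a)))))

≈ℝ-trans : ∀ {a b c} → a ≈ℝ b → b ≈ℝ c → a ≈ℝ c
≈ℝ-trans {a} {b} {c} h k = ∼⇒≈ {a} {c} (∼-trans (≈⇒∼ {a} {b} h) (≈⇒∼ {b} {c} k))

≈Pt-trans : ∀ P Q R → P ≈Pt Q → Q ≈Pt R → P ≈Pt R
≈Pt-trans P Q R (h , k) (h′ , k′) = ≈ℝ-trans {x-coord P} {x-coord Q} {x-coord R} h h′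
  , ≈ℝ-trans {y-coord P} {y-coord Q} {y-coord R} k k′

≈ℝ-sym : ∀ {a b} → a ≈ℝ b → b ≈ℝ a
≈ℝ-sym {a} {b} h = ∼⇒≈ {b} {a} (∼-sym (≈⇒∼ {a} {b} h))

≈Pt-sym : ∀ P Q → P ≈Pt Q → Q ≈Pt P
≈Pt-sym P Q (h , k) = ≈ℝ-sym {x-coord P} {x-coord Q} h , ≈ℝ-sym {y-coord P} {y-coord Q} k

-- Multiplication by −1 + i on ℤ[i].
M : ℤ² → ℤ²
M (a , b) = ℤ.- a ℤ.- b , a ℤ.- b

M^ : ℕ → ℤ² → ℤ²
M^ zero    u = u
M^ (suc k) u = M (M^ k u)

M^-+ : ∀ m n u → M^ (m ℕ.+ n) u ≡ M^ m (M^ n u)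
M^-+ zero    n u = refl
M^-+ (suc m) n u = cong M (M^-+ m n u)

det-M : ∀ u v → det (M u) (M v) ≡ + 2 ℤ.* det u v
det-M (a , b) (c , d) = eq a b c d
  where
  eq : ∀ a b c d → (ℤ.- a ℤ.- b) ℤ.* (c ℤ.- d) ℤ.- (a ℤ.- b) ℤ.* (ℤ.- c ℤ.- d) ≡ + 2 ℤ.* (a ℤ.* d ℤ.- b ℤ.* c)
  eq = ℤ-solve-∀

det-M^ : ∀ k u v → det (M^ k u) (M^ k v) ≡ + (2 ^ k) ℤ.* det u v
det-M^ zero    u v = sym (ℤ.*-identityˡ (det u v))
det-M^ (suc k) u v = begin
  det (M (M^ k u)) (M (M^ k v))           ≡⟨ det-M (M^ k u) (M^ k v) ⟩
  + 2 ℤ.* det (M^ k u) (M^ k v)           ≡⟨ cong (+ 2 ℤ.*_) (det-M^ k u v) ⟩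
  + 2 ℤ.* (+ (2 ^ k) ℤ.* det u v)         ≡⟨ ℤ.*-assoc (+ 2) (+ (2 ^ k)) (det u v) ⟨
  + 2 ℤ.* + (2 ^ k) ℤ.* det u v           ≡⟨ cong (ℤ._* det u v) (ℤ.pos-* 2 (2 ^ k)) ⟨
  + (2 ^ suc k) ℤ.* det u v               ∎
  where open ≡-Reasoning

-- The fourth power of -1 + i is -4.
det-M⁴ : ∀ u v → det (M^ 4 u) v ≡ -[1+ 3 ] ℤ.* det u v
det-M⁴ (a , b) (c , d) = eq a b c d
  where
  eq : ∀ a b c d →
    let a₁ = ℤ.- a ℤ.- b ; b₁ = a ℤ.- b ; a₂ = ℤ.- a₁ ℤ.- b₁ ; b₂ = a₁ ℤ.- b₁
        a₃ = ℤ.- a₂ ℤ.- b₂ ; b₃ = a₂ ℤ.- b₂ in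
    (ℤ.- a₃ ℤ.- b₃) ℤ.* d ℤ.- (a₃ ℤ.- b₃) ℤ.* c ≡ -[1+ 3 ] ℤ.* (a ℤ.* d ℤ.- b ℤ.* c)
  eq = ℤ-solve-∀

0<2^ : ∀ k → ℤ.Positive (+ (2 ^ k))
0<2^ k = ℤ.positive (ℤ.+<+ (ℕ.m^n>0 2 k))

-- `M` multiplies every determinant by 2, the squared modulus of -1 + i, so a separating line is
-- carried to a separating line with `c` scaled by a power of 2.
M^-separated : ∀ k {w c u v x y} → Separated w c u v x y →
  Separated (M^ k w) (+ (2 ^ k) ℤ.* c) (M^ k u) (M^ k v) (M^ k x) (M^ k y)
M^-separated k {w} {c} {u} {v} {x} {y} (separated c≤u c≤v x≤c y≤c strict) =
  separated (above u c≤u) (above v c≤v) (below x x≤c) (below y y≤c)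
    (subst₂ ℤ._<_ (sum x y) (sum u v) (ℤ.*-monoˡ-<-pos (+ (2 ^ k)) {{0<2^ k}} strict))
  where
  above : ∀ u → c ℤ.≤ det w u → + (2 ^ k) ℤ.* c ℤ.≤ det (M^ k w) (M^ k u)
  above u h = subst (_ ℤ.≤_) (sym (det-M^ k w u)) (ℤ.*-monoˡ-≤-nonNeg (+ (2 ^ k)) h)
  below : ∀ u → det w u ℤ.≤ c → det (M^ k w) (M^ k u) ℤ.≤ + (2 ^ k) ℤ.* c
  below u h = subst (ℤ._≤ _) (sym (det-M^ k w u)) (ℤ.*-monoˡ-≤-nonNeg (+ (2 ^ k)) h)
  sum : ∀ u v → + (2 ^ k) ℤ.* (det w u ℤ.+ det w v) ≡ det (M^ k w) (M^ k u) ℤ.+ det (M^ k w) (M^ k v)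
  sum u v = trans (ℤ.*-distribˡ-+ (+ (2 ^ k)) (det w u) (det w v)) (sym (cong₂ ℤ._+_ (det-M^ k w u) (det-M^ k w v)))

M^-transverse : ∀ k {w u v x y} → Transverse w u v x y →
  Transverse (M^ k w) (M^ k u) (M^ k v) (M^ k x) (M^ k y)
M^-transverse k {w} {u} {v} {x} {y} (transverse x≡y u≢v) = transverse
  (trans (det-M^ k w x) (trans (cong (+ (2 ^ k) ℤ.*_) x≡y) (sym (det-M^ k w y))))
  (λ eq → u≢v (ℤ.*-cancelˡ-≡ (+ (2 ^ k)) _ _ {{ℕ.m^n≢0 2 k}}
    (trans (sym (det-M^ k w u)) (trans eq (det-M^ k w v)))))

opposite : ℤ² → ℤ²
opposite (a , b) = ℤ.- a , ℤ.- b

det-opposite : ∀ w u → det (opposite w) u ≡ ℤ.- det w u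
det-opposite (a , b) (c , d) = eq a b c d
  where
  eq : ∀ a b c d → (ℤ.- a) ℤ.* d ℤ.- (ℤ.- b) ℤ.* c ≡ ℤ.- (a ℤ.* d ℤ.- b ℤ.* c)
  eq = ℤ-solve-∀

Separable : ℤ² → ℤ² → ℤ² → ℤ² → Set
Separable u v x y = ∃[ w ] ∃[ c ] Separated w c u v x y

separable-sym : ∀ {u v x y} → Separable u v x y → Separable x y u v
separable-sym {u} {v} {x} {y} (w , c , separated c≤u c≤v x≤c y≤c strict) = opposite w , ℤ.- c ,
  separated (above x x≤c) (above y y≤c) (below u c≤u) (below v c≤v)
    (subst₂ ℤ._<_ (sum u v) (sum x y) (ℤ.neg-mono-< strict))
  where
  above : ∀ x → det w x ℤ.≤ c → ℤ.- c ℤ.≤ det (opposite w) x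
  above x h = subst (_ ℤ.≤_) (sym (det-opposite w x)) (ℤ.neg-mono-≤ h)
  below : ∀ u → c ℤ.≤ det w u → det (opposite w) u ℤ.≤ ℤ.- c
  below u h = subst (ℤ._≤ _) (sym (det-opposite w u)) (ℤ.neg-mono-≤ h)
  sum : ∀ u v → ℤ.- (det w u ℤ.+ det w v) ≡ det (opposite w) u ℤ.+ det (opposite w) v
  sum u v = trans (ℤ.neg-distrib-+ (det w u) (det w v)) (sym (cong₂ ℤ._+_ (det-opposite w u) (det-opposite w v)))

M^-separable : ∀ k {u v x y} → Separable u v x y → Separable (M^ k u) (M^ k v) (M^ k x) (M^ k y)
M^-separable k (w , c , sep) = M^ k w , + (2 ^ k) ℤ.* c , M^-separated k sep

-- The periodic drawing

infix 6 _⇢_rising_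

-- One orbit of edges under the screw motion: the edge starting at level `l` ends at level
-- `l + rise`.
record Shape : Set where
  constructor _⇢_rising_
  field
    from to : Fin 6
    rise    : ℕ

edgeShape : Fin 15 → Shape
edgeShape = lookup
  -- First the sides of the triangles 0 1 2 and 3 4 5, then the three edges joining different
  -- triangles, then the six chords of the 12-gon. Each orbit is an end of three of the first nine
  -- and of two of the chords.
  ( # 0 ⇢ # 1 rising 0 ∷ # 1 ⇢ # 2 rising 0 ∷ # 0 ⇢ # 2 rising 0
  ∷ # 3 ⇢ # 4 rising 0 ∷ # 4 ⇢ # 5 rising 0 ∷ # 3 ⇢ # 5 rising 0
  ∷ # 0 ⇢ # 3 rising 0 ∷ # 4 ⇢ # 1 rising 3 ∷ # 2 ⇢ # 5 rising 2
  ∷ # 4 ⇢ # 3 rising 5 ∷ # 0 ⇢ # 2 rising 3 ∷ # 4 ⇢ # 5 rising 2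
  ∷ # 0 ⇢ # 1 rising 5 ∷ # 5 ⇢ # 3 rising 3 ∷ # 2 ⇢ # 1 rising 2 ∷ [])

-- Edges and vertices are treated together, so a single analysis of positions yields the crossings,
-- the avoidance of vertices and the distinctness of vertices.
Kind : Set
Kind = Fin 15 ⊎ Fin 6

shape : Kind → Shape
shape (inj₁ t) = edgeShape t
shape (inj₂ j) = j ⇢ j rising 0

open Shape

-- Gaussian integers, so that all levels `M^ l` remain in ℤ². That these coordinates give the
-- required crossing pattern is verified by `near` and by the barrier lemmas.
base : Fin 6 → ℤ²
base = lookup ((+ 6 , + 3) ∷ (+ 5 , + 1) ∷ (+ 8 , + 0) ∷ (+ 5 , + 5) ∷ (+ 5 , + 8) ∷ (+ 2 , + 5) ∷ [])

place : ℕ → Fin 6 → ℤ²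
place l j = M^ l (base j)

tail head : ℕ → Kind → ℤ²
tail l s = place l (from (shape s))
head l s = place (l ℕ.+ rise (shape s)) (to (shape s))

tail-+ : ∀ l k s → tail (l ℕ.+ k) s ≡ M^ l (tail k s)
tail-+ l k s = M^-+ l k _

head-+ : ∀ l k s → head (l ℕ.+ k) s ≡ M^ l (head k s)
head-+ l k s = trans (cong (λ m → place m (to (shape s))) (ℕ.+-assoc l k _)) (M^-+ l _ _)

-- The two chords crossing a chord, with their levels relative to it. The six chords of a 12-gon
-- cross cyclically; the values at kinds other than chords (9 to 14) are junk.
neighbour : Kind → Fin 2 → Kind × ℤ
neighbour (inj₁ t) zero       = lookup
  (dummy ∷ dummy ∷ dummy ∷ dummy ∷ dummy ∷ dummy ∷ dummy ∷ dummy ∷ dummy ∷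
   (inj₁ (# 10) , + 0) ∷ (inj₁ (# 11) , + 0) ∷ (inj₁ (# 12) , + 0) ∷
   (inj₁ (# 13) , + 2) ∷ (inj₁ (# 14) , + 1) ∷ (inj₁ (# 9) , -[1+ 2 ]) ∷ []) t
  where dummy = inj₁ (# 0) , + 0
neighbour (inj₁ t) (suc zero) = lookup
  (dummy ∷ dummy ∷ dummy ∷ dummy ∷ dummy ∷ dummy ∷ dummy ∷ dummy ∷ dummy ∷
   (inj₁ (# 14) , + 3) ∷ (inj₁ (# 9) , + 0) ∷ (inj₁ (# 10) , + 0) ∷
   (inj₁ (# 11) , + 0) ∷ (inj₁ (# 12) , -[1+ 1 ]) ∷ (inj₁ (# 13) , -[1+ 0 ]) ∷ []) t
  where dummy = inj₁ (# 0) , + 0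
neighbour (inj₂ j) _ = inj₁ (# 0) , + 0

-- Finite check for nearby levels

_-²_ : ℤ² → ℤ² → ℤ²
(a , b) -² (c , d) = a ℤ.- c , b ℤ.- d

rotate : ℤ² → ℤ²
rotate (a , b) = ℤ.- b , a

-- Candidate directions of separating lines: parallel to one of the segments, or perpendicular to a
-- segment or to `x -² u`. The perpendicular ones serve for degenerate and collinear segments, where
-- the parallel ones can fail.
normals : (u v x y : ℤ²) → List ℤ²
normals u v x y = v -² u ∷ u -² v ∷ y -² x ∷ x -² y
  ∷ rotate (x -² u) ∷ rotate (v -² u) ∷ rotate (u -² v) ∷ rotate (y -² x) ∷ rotate (x -² y) ∷ []

separated? : ∀ w c u v x y → Dec (Separated w c u v x y)
separated? w c u v x y = map′ (λ (a , b , c , d , e) → separated a b c d e)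
  (λ (separated a b c d e) → a , b , c , d , e)
  (c ℤ.≤? det w u ×-dec c ℤ.≤? det w v ×-dec det w x ℤ.≤? c ×-dec det w y ℤ.≤? c
    ×-dec det w x ℤ.+ det w y ℤ.<? det w u ℤ.+ det w v)

transverse? : ∀ w u v x y → Dec (Transverse w u v x y)
transverse? w u v x y = map′ (λ (a , b) → transverse a b) (λ (transverse a b) → a , b)
  (det w x ℤ.≟ det w y ×-dec ¬? (det w u ℤ.≟ det w v))

_≟Kind_ : (s t : Kind) → Dec (s ≡ t)
_≟Kind_ = Sum.≡-dec Fin._≟_ Fin._≟_

-- A decidable counterpart of `Position` with lower level 0. The offset is the larger value at `x₀`
-- and `y₀`, the least one possible for a given normal. A crossing is listed from both sides, with
-- opposite level shifts.
Near : ℕ → Kind → Kind → Set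
Near k s t = (k ≡ 0 × s ≡ t)
  ⊎ Any (λ w → Separated w (det w x₀ ℤ.⊔ det w y₀) u v x₀ y₀) (normals u v x₀ y₀)
  ⊎ ((∃[ i ] neighbour s i ≡ (t , + k)) × Transverse (y₀ -² x₀) u v x₀ y₀)
    × ((∃[ i ] neighbour t i ≡ (s , ℤ.- (+ k))) × Transverse (v -² u) x₀ y₀ u v)
  where
  u = tail 0 s
  v = head 0 s
  x₀ = tail k t
  y₀ = head k t

near? : ∀ k s t → Dec (Near k s t)
near? k s t = (k ℕ.≟ 0 ×-dec s ≟Kind t)
  ⊎-dec Any.any? (λ w → separated? w (det w x₀ ℤ.⊔ det w y₀) u v x₀ y₀) (normals u v x₀ y₀)
  ⊎-dec (Fin.any? (λ i → Product.≡-dec _≟Kind_ ℤ._≟_ (neighbour s i) (t , + k)) ×-dec transverse? (y₀ -² x₀) u v x₀ y₀)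
    ×-dec (Fin.any? (λ i → Product.≡-dec _≟Kind_ ℤ._≟_ (neighbour t i) (s , ℤ.- (+ k))) ×-dec transverse? (v -² u) x₀ y₀ u v)
  where
  u = tail 0 s
  v = head 0 s
  x₀ = tail k t
  y₀ = head k t

allKinds? : {P : Kind → Set} → (∀ s → Dec (P s)) → Dec (∀ s → P s)
allKinds? P? = map′ (λ (h , k) → λ { (inj₁ t) → h t ; (inj₂ j) → k j }) (λ h → h ∘ inj₁ , h ∘ inj₂)
  (Fin.all? (P? ∘ inj₁) ×-dec Fin.all? (P? ∘ inj₂))

-- Level differences 0 to 5 are checked by computation; from 6 on, both ends of the lower edge lie
-- below the level of the upper one and `far-separable` applies.
near : ∀ (k : Fin 6) s t → Near (toℕ k) s t
near = toWitness {a? = Fin.all? λ k → allKinds? λ s → allKinds? λ t → near? (toℕ k) s t} _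

-- The line det (normal s) = offset s has the shape s on one side and, on the other side, the
-- origin and with it everything on the levels below 0: descending contracts towards the origin.
barrier : Kind → ℤ² × ℕ
barrier (inj₁ t) = lookup
  (a ∷ a ∷ a ∷ a ∷ b ∷ b ∷ a ∷ a ∷ a ∷ a ∷ a ∷ a ∷ a ∷ b ∷ ((-[1+ 0 ] , -[1+ 1 ]) , 14) ∷ []) t
  where
  a = (+ 0 , -[1+ 0 ]) , 5
  b = (+ 9 , -[1+ 3 ]) , 53
barrier (inj₂ j) = lookup (a ∷ a ∷ a ∷ a ∷ a ∷ b ∷ []) j
  where
  a = (+ 0 , -[1+ 0 ]) , 5
  b = (+ 9 , -[1+ 3 ]) , 53

normal : Kind → ℤ²
normal = proj₁ ∘ barrier

offset : Kind → ℕ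
offset = proj₂ ∘ barrier

beyond-barrier : ∀ s → + offset s ℤ.≤ det (normal s) (tail 0 s) × + offset s ℤ.≤ det (normal s) (head 0 s)
beyond-barrier = toWitness {a? = allKinds? λ s →
  (+ offset s ℤ.≤? det (normal s) (tail 0 s)) ×-dec (+ offset s ℤ.≤? det (normal s) (head 0 s))} _

rise≤5 : ∀ s → rise (shape s) ℕ.≤ 5
rise≤5 = toWitness {a? = allKinds? λ s → rise (shape s) ℕ.≤? 5} _

-- The determinant is `2 ^ suc i` times the value of `det (normal s)` at orbit `j` on level -(i +
-- 1); applying `M` to the normal instead avoids fractions. As the fourth power of `M` is -4, four
-- more steps multiply the left side by 4 and the right side by 16, so four initial cases suffice.
-- The absolute value absorbs the sign.
before-barrier : ∀ i s j → ℤ.∣ det (M^ (suc i) (normal s)) (base j) ∣ ℕ.< 2 ^ suc i ℕ.* offset s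
before-barrier = go
  where
  initial : ∀ (i : Fin 4) s j → ℤ.∣ det (M^ (suc (toℕ i)) (normal s)) (base j) ∣ ℕ.< 2 ^ suc (toℕ i) ℕ.* offset s
  initial = toWitness {a? = Fin.all? λ i → allKinds? λ s → Fin.all? λ j →
    ℤ.∣ det (M^ (suc (toℕ i)) (normal s)) (base j) ∣ ℕ.<? 2 ^ suc (toℕ i) ℕ.* offset s} _
  go : ∀ i s j → ℤ.∣ det (M^ (suc i) (normal s)) (base j) ∣ ℕ.< 2 ^ suc i ℕ.* offset s
  go 0 = initial (# 0)
  go 1 = initial (# 1)
  go 2 = initial (# 2)
  go 3 = initial (# 3)
  go (suc (suc (suc (suc i)))) s j = begin-strict
    ℤ.∣ det (M^ 4 (M^ (suc i) (normal s))) (base j) ∣    ≡⟨ cong ℤ.∣_∣ (det-M⁴ (M^ (suc i) (normal s)) (base j)) ⟩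
    ℤ.∣ -[1+ 3 ] ℤ.* D ∣                                 ≡⟨ ℤ.abs-* -[1+ 3 ] D ⟩
    4 ℕ.* ℤ.∣ D ∣                                        <⟨ ℕ.*-monoʳ-< 4 (go i s j) ⟩
    4 ℕ.* X                                              ≤⟨ ℕ.*-monoˡ-≤ X (ℕ.m≤m+n 4 12) ⟩
    16 ℕ.* X                                             ≡⟨ ℕ.*-assoc 16 (2 ^ suc i) (offset s) ⟨
    16 ℕ.* 2 ^ suc i ℕ.* offset s                        ≡⟨ cong (ℕ._* offset s) (ℕ.^-distribˡ-+-* 2 4 (suc i)) ⟨
    2 ^ (4 ℕ.+ suc i) ℕ.* offset s                       ∎
    where
    open ℕ.≤-Reasoning
    D : ℤ
    D = det (M^ (suc i) (normal s)) (base j)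
    X : ℕ
    X = 2 ^ suc i ℕ.* offset s

-- Cancelling `M^ d` puts the point on level 0 and leaves `k - d` steps on the normal, the case of
-- `before-barrier` with i = k - d - 1.
below-barrier : ∀ {k d} s j → d ℕ.< k → det (M^ k (normal s)) (place d j) ℤ.< + (2 ^ k) ℤ.* + offset s
below-barrier {k} {d} s j d<k with ℕ.m≤n⇒∃[o]m+o≡n d<k
... | i , refl = begin-strict
  det (M^ (suc d ℕ.+ i) (normal s)) (M^ d (base j))
    ≡⟨ cong (λ m → det (M^ m (normal s)) (M^ d (base j))) (ℕ.+-suc d i) ⟨
  det (M^ (d ℕ.+ suc i) (normal s)) (M^ d (base j))
    ≡⟨ cong (λ w → det w (M^ d (base j))) (M^-+ d (suc i) (normal s)) ⟩
  det (M^ d (M^ (suc i) (normal s))) (M^ d (base j))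
    ≡⟨ det-M^ d (M^ (suc i) (normal s)) (base j) ⟩
  + (2 ^ d) ℤ.* det (M^ (suc i) (normal s)) (base j)
    <⟨ ℤ.*-monoˡ-<-pos (+ (2 ^ d)) {{0<2^ d}}
         (ℤ.≤-<-trans (i≤+∣i∣ _) (ℤ.+<+ (before-barrier i s j))) ⟩
  + (2 ^ d) ℤ.* + (2 ^ suc i ℕ.* offset s)
    ≡⟨ ℤ.pos-* (2 ^ d) (2 ^ suc i ℕ.* offset s) ⟨
  + (2 ^ d ℕ.* (2 ^ suc i ℕ.* offset s))
    ≡⟨ cong +_ (ℕ.*-assoc (2 ^ d) (2 ^ suc i) (offset s)) ⟨
  + (2 ^ d ℕ.* 2 ^ suc i ℕ.* offset s)
    ≡⟨ cong (λ p → + (p ℕ.* offset s)) (ℕ.^-distribˡ-+-* 2 d (suc i)) ⟨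
  + (2 ^ (d ℕ.+ suc i) ℕ.* offset s)
    ≡⟨ cong (λ m → + (2 ^ m ℕ.* offset s)) (ℕ.+-suc d i) ⟩
  + (2 ^ (suc d ℕ.+ i) ℕ.* offset s)
    ≡⟨ ℤ.pos-* (2 ^ (suc d ℕ.+ i)) (offset s) ⟩
  + (2 ^ (suc d ℕ.+ i)) ℤ.* + offset s ∎
  where open ℤ.≤-Reasoning

-- The separating line is the barrier of the upper shape `t` carried to level `k`. By `rise≤5` both
-- ends of the lower segment are on levels at most 5, hence on the origin side.
far-separable : ∀ k s t → 6 ℕ.≤ k → Separable (tail k t) (head k t) (tail 0 s) (head 0 s)
far-separable k s t 6≤k = M^ k (normal t) , C , separated tail-above head-above (ℤ.<⇒≤ tail-below) (ℤ.<⇒≤ head-below)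
  (ℤ.<-≤-trans (ℤ.+-mono-< tail-below head-below) (ℤ.+-mono-≤ tail-above head-above))
  where
  C : ℤ
  C = + (2 ^ k) ℤ.* + offset t
  above : ∀ p → + offset t ℤ.≤ det (normal t) p → C ℤ.≤ det (M^ k (normal t)) (M^ k p)
  above p h = subst (C ℤ.≤_) (sym (det-M^ k (normal t) p)) (ℤ.*-monoˡ-≤-nonNeg (+ (2 ^ k)) h)
  tail-above : C ℤ.≤ det (M^ k (normal t)) (tail k t)
  tail-above = above (tail 0 t) (proj₁ (beyond-barrier t))
  head-above : C ℤ.≤ det (M^ k (normal t)) (head k t)
  head-above = subst (λ p → C ℤ.≤ det (M^ k (normal t)) p) (sym (M^-+ k (rise (shape t)) (base (to (shape t)))))
    (above (head 0 t) (proj₂ (beyond-barrier t)))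
  tail-below : det (M^ k (normal t)) (tail 0 s) ℤ.< C
  tail-below = below-barrier t (from (shape s)) (ℕ.≤-trans (ℕ.s≤s ℕ.z≤n) 6≤k)
  head-below : det (M^ k (normal t)) (head 0 s) ℤ.< C
  head-below = below-barrier t (to (shape s)) (ℕ.≤-trans (ℕ.s≤s (rise≤5 s)) 6≤k)

-- Relative positions at arbitrary levels

SeparableAt : ℕ → Kind → ℕ → Kind → Set
SeparableAt l s m t = Separable (tail l s) (head l s) (tail m t) (head m t)

-- `index` together with `l` and `s` determines `m` and `t`; having only two indices is what bounds
-- the crossings by two.
record CrossingAt (l : ℕ) (s : Kind) (m : ℕ) (t : Kind) : Set where
  constructor crossing
  field
    {shift}     : ℤ
    index       : Fin 2
    is-neighbour : neighbour s index ≡ (t , shift)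
    level-shift : + m ≡ + l ℤ.+ shift
    {direction} : ℤ²
    is-transverse : Transverse direction (tail l s) (head l s) (tail m t) (head m t)

data Position (l : ℕ) (s : Kind) (m : ℕ) (t : Kind) : Set where
  same  : l ≡ m → s ≡ t → Position l s m t
  apart : SeparableAt l s m t → Position l s m t
  cross : CrossingAt l s m t → CrossingAt m t l s → Position l s m t

position-sym : ∀ {l s m t} → Position l s m t → Position m t l s
position-sym (same l≡m s≡t) = same (sym l≡m) (sym s≡t)
position-sym (apart sep)    = apart (separable-sym sep)
position-sym (cross c d)    = cross d c

lift-separable : ∀ l k {s t} → SeparableAt 0 s k t → SeparableAt l s (l ℕ.+ k) t
lift-separable l k {s} {t} sep =
  subst₂ (λ v x → Separable (tail l s) v x (head (l ℕ.+ k) t)) (sym (M^-+ l _ _)) (sym (tail-+ l k t))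
    (subst (Separable _ _ _) (sym (head-+ l k t)) (M^-separable l sep))

lift-transverse : ∀ l k {w s t} → Transverse w (tail 0 s) (head 0 s) (tail k t) (head k t) →
  Transverse (M^ l w) (tail l s) (head l s) (tail (l ℕ.+ k) t) (head (l ℕ.+ k) t)
lift-transverse l k {w} {s} {t} tr =
  subst₂ (λ v x → Transverse (M^ l w) (tail l s) v x (head (l ℕ.+ k) t)) (sym (M^-+ l _ _)) (sym (tail-+ l k t))
    (subst (Transverse _ _ _ _) (sym (head-+ l k t)) (M^-transverse l tr))

lift-transverse′ : ∀ l k {w s t} → Transverse w (tail k t) (head k t) (tail 0 s) (head 0 s) →
  Transverse (M^ l w) (tail (l ℕ.+ k) t) (head (l ℕ.+ k) t) (tail l s) (head l s)
lift-transverse′ l k {w} {s} {t} tr =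
  subst₂ (λ u y → Transverse (M^ l w) u (head (l ℕ.+ k) t) (tail l s) y) (sym (tail-+ l k t)) (sym (M^-+ l _ _))
    (subst (λ v → Transverse (M^ l w) (M^ l (tail k t)) v (tail l s) (M^ l (head 0 s))) (sym (head-+ l k t)) (M^-transverse l tr))

-- Dividing by `M^ l` moves the lower segment to level 0, where either the finite check or the
-- barrier decides.
locate-up : ∀ l s k t → Position l s (l ℕ.+ k) t
locate-up l s k t with k ℕ.<? 6
... | no  k≮6 = apart (lift-separable l k {s} {t} (separable-sym (far-separable k s t (ℕ.≮⇒≥ k≮6))))
... | yes k<6 = from-near (subst (λ k → Near k s t) (Fin.toℕ-fromℕ< k<6) (near (fromℕ< k<6) s t))
  where
  down : ∀ l k → l ≡ l ℤ.+ k ℤ.+ (ℤ.- k)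
  down = ℤ-solve-∀
  from-near : Near k s t → Position l s (l ℕ.+ k) t
  from-near (inj₁ (refl , s≡t)) = same (sym (ℕ.+-identityʳ l)) s≡t
  from-near (inj₂ (inj₁ any)) with Any.satisfied any
  ... | w , sep = apart (lift-separable l k {s} {t} (w , _ , sep))
  from-near (inj₂ (inj₂ (((i , eq) , tr) , ((i′ , eq′) , tr′)))) = cross
    (crossing i eq (ℤ.pos-+ l k) (lift-transverse l k {_} {s} {t} tr))
    (crossing i′ eq′ (trans (down (+ l) (+ k)) (cong (ℤ._+ (ℤ.- + k)) (sym (ℤ.pos-+ l k)))) (lift-transverse′ l k {_} {s} {t} tr′))

locate : ∀ l s m t → Position l s m t
locate l s m t with ℕ.≤-total l m
... | inj₁ l≤m = subst (λ m → Position l s m t) (ℕ.m+[n∸m]≡n l≤m) (locate-up l s (m ℕ.∸ l) t)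
... | inj₂ m≤l = position-sym (subst (λ l → Position m t l s) (ℕ.m+[n∸m]≡n m≤l) (locate-up m t (l ℕ.∸ m) s))

-- The graph

-- Vertices are numbered level by level, six on each, so the graph on `n` vertices is induced on the
-- first `n` vertices of one infinite graph.
level : ℕ → ℕ
level a = a ℕ./ 6

orbit : ℕ → Fin 6
orbit a = a mod 6

number : ℕ → Fin 6 → ℕ
number l j = toℕ j ℕ.+ l ℕ.* 6

number-level-orbit : ∀ a → a ≡ number (level a) (orbit a)
number-level-orbit a = DivMod.property (a divMod 6)

level-number : ∀ l j → level (number l j) ≡ l
level-number l j = trans (+-distrib-/-∣ʳ (toℕ j) (n∣m*n l))
  (cong₂ ℕ._+_ (m<n⇒m/n≡0 (Fin.toℕ<n j)) (m*n/n≡m l 6))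

orbit-number : ∀ l j → orbit (number l j) ≡ j
orbit-number l j = Fin.toℕ-injective (trans (Fin.toℕ-fromℕ< _)
  (trans ([m+kn]%n≡m%n (toℕ j) l 6) (m<n⇒m%n≡m (Fin.toℕ<n j))))

level-orbit-injective : ∀ {a b} → level a ≡ level b → orbit a ≡ orbit b → a ≡ b
level-orbit-injective {a} {b} l≡ o≡ =
  trans (number-level-orbit a) (trans (cong₂ number l≡ o≡) (sym (number-level-orbit b)))

record LinkedBy (a b : ℕ) (t : Fin 15) : Set where
  constructor linked
  field
    orbit-src : orbit a ≡ from (edgeShape t)
    orbit-tgt : orbit b ≡ to (edgeShape t)
    level-tgt : level b ≡ level a ℕ.+ rise (edgeShape t)

Linked : ℕ → ℕ → Set
Linked a b = ∃[ t ] LinkedBy a b t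

linked? : ∀ a b → Dec (Linked a b)
linked? a b = Fin.any? λ t → map′ (λ (p , q , r) → linked p q r) (λ (linked p q r) → p , q , r)
  (orbit a Fin.≟ from (edgeShape t) ×-dec orbit b Fin.≟ to (edgeShape t)
    ×-dec level b ℕ.≟ level a ℕ.+ rise (edgeShape t))

-- Shapes that stay on their level go to an orbit of larger number. This gives irreflexivity and
-- makes the smaller end of an edge the tail of its shape.
linked⇒< : ∀ {a b} → Linked a b → a ℕ.< b
linked⇒< {a} {b} (t , linked o≡ o≡′ l≡) = begin-strict
  a                                               ≡⟨ number-level-orbit a ⟩
  number (level a) (orbit a)                      ≡⟨ cong (number (level a)) o≡ ⟩
  toℕ (from s) ℕ.+ level a ℕ.* 6                  <⟨ ℕ.+-monoˡ-< (level a ℕ.* 6) (ascending t) ⟩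
  toℕ (to s) ℕ.+ rise s ℕ.* 6 ℕ.+ level a ℕ.* 6   ≡⟨ ℕ.+-assoc (toℕ (to s)) (rise s ℕ.* 6) (level a ℕ.* 6) ⟩
  toℕ (to s) ℕ.+ (rise s ℕ.* 6 ℕ.+ level a ℕ.* 6) ≡⟨ cong (toℕ (to s) ℕ.+_) (ℕ.*-distribʳ-+ 6 (rise s) (level a)) ⟨
  toℕ (to s) ℕ.+ (rise s ℕ.+ level a) ℕ.* 6       ≡⟨ cong (λ l → toℕ (to s) ℕ.+ l ℕ.* 6) (ℕ.+-comm (rise s) (level a)) ⟩
  number (level a ℕ.+ rise s) (to s)              ≡⟨ cong₂ number l≡ o≡′ ⟨
  number (level b) (orbit b)                      ≡⟨ number-level-orbit b ⟨
  b                                               ∎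
  where
  open ℕ.≤-Reasoning
  s : Shape
  s = edgeShape t
  ascending : ∀ t → toℕ (from (edgeShape t)) ℕ.< toℕ (to (edgeShape t)) ℕ.+ rise (edgeShape t) ℕ.* 6
  ascending = toWitness {a? = Fin.all? λ t →
    toℕ (from (edgeShape t)) ℕ.<? toℕ (to (edgeShape t)) ℕ.+ rise (edgeShape t) ℕ.* 6} _

module _ (n : ℕ) where

  G : Graph n
  G = record
    { adj         = λ u v → isYes (linked? (toℕ u) (toℕ v)) ∨ isYes (linked? (toℕ v) (toℕ u))
    ; symmetric   = λ u v → ∨-comm (isYes (linked? (toℕ u) (toℕ v))) _
    ; irreflexive = λ v → cong₂ _∨_ (unlinked (toℕ v)) (unlinked (toℕ v))
    }
    where
    unlinked : ∀ a → isYes (linked? a a) ≡ false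
    unlinked a = trans (isYes≗does (linked? a a)) (dec-false (linked? a a) (ℕ.<-irrefl refl ∘ linked⇒<))

  adj⇒linked : ∀ {u v} → Graph.Adj G u v → Linked (toℕ u) (toℕ v) ⊎ Linked (toℕ v) (toℕ u)
  adj⇒linked {u} {v} h = Sum.map (toWitness {a? = linked? (toℕ u) (toℕ v)}) (toWitness {a? = linked? (toℕ v) (toℕ u)})
    (Equivalence.to T-∨ h)

  linked⇒adj : ∀ {u v} → Linked (toℕ u) (toℕ v) → Graph.Adj G u v
  linked⇒adj {u} {v} h = Equivalence.from T-∨ (inj₁ (fromWitness {a? = linked? (toℕ u) (toℕ v)} h))

-- C₄-freeness

-- Shapes with a direction of travel, `inj₂` against the shape. Paths are compared by their orbits
-- and their total climb.
HalfEdge : Set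
HalfEdge = Fin 15 ⊎ Fin 15

source target : HalfEdge → Fin 6
source (inj₁ t) = from (edgeShape t)
source (inj₂ t) = to (edgeShape t)
target (inj₁ t) = to (edgeShape t)
target (inj₂ t) = from (edgeShape t)

climb : HalfEdge → ℤ
climb (inj₁ t) = + rise (edgeShape t)
climb (inj₂ t) = ℤ.- (+ rise (edgeShape t))

record Step (a : ℕ) (h : HalfEdge) (b : ℕ) : Set where
  constructor step
  field
    orbit-source : orbit a ≡ source h
    orbit-target : orbit b ≡ target h
    level-climb  : + level b ≡ + level a ℤ.+ climb h

adj⇒step : ∀ {n u v} → Graph.Adj (G n) u v → ∃[ h ] Step (toℕ u) h (toℕ v)
adj⇒step {n} {u} {v} uv with adj⇒linked n {u} {v} uv
... | inj₁ (t , linked p q r) = inj₁ t , step p q (trans (cong +_ r) (ℤ.pos-+ (level (toℕ u)) _))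
... | inj₂ (t , linked p q r) = inj₂ t , step q p
  (trans (down (+ level (toℕ v)) (+ rise (edgeShape t)))
    (cong (ℤ._+ (ℤ.- (+ rise (edgeShape t)))) (sym (trans (cong +_ r) (ℤ.pos-+ (level (toℕ v)) _)))))
  where
  down : ∀ l k → l ≡ l ℤ.+ k ℤ.+ (ℤ.- k)
  down = ℤ-solve-∀

allHalfEdges? : {P : HalfEdge → Set} → (∀ h → Dec (P h)) → Dec (∀ h → P h)
allHalfEdges? P? = map′ (λ (f , g) → λ { (inj₁ t) → f t ; (inj₂ t) → g t }) (λ f → f ∘ inj₁ , f ∘ inj₂)
  (Fin.all? (P? ∘ inj₁) ×-dec Fin.all? (P? ∘ inj₂))

abstract
  -- Two paths of length two with the same ends, seen up to the screw motion: either they begin with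
  -- the same half-edge or the first returns to its start. The hypotheses stand between the
  -- quantifiers so that the check drops half-edges that do not compose before it ranges over
  -- further ones.
  two-steps-rigid : ∀ h₁ h₂ → target h₁ ≡ source h₂ → ∀ h₃ → source h₁ ≡ source h₃ →
    ∀ h₄ → target h₃ ≡ source h₄ → target h₂ ≡ target h₄ × climb h₁ ℤ.+ climb h₂ ≡ climb h₃ ℤ.+ climb h₄ →
    h₁ ≡ h₃ ⊎ (target h₂ ≡ source h₁ × climb h₁ ℤ.+ climb h₂ ≡ + 0)
  two-steps-rigid = toWitness {a? = allHalfEdges? λ h₁ → allHalfEdges? λ h₂ → (target h₁ Fin.≟ source h₂) →-dec
    (allHalfEdges? λ h₃ → (source h₁ Fin.≟ source h₃) →-dec
    (allHalfEdges? λ h₄ → (target h₃ Fin.≟ source h₄) →-dec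
      ((target h₂ Fin.≟ target h₄ ×-dec climb h₁ ℤ.+ climb h₂ ℤ.≟ climb h₃ ℤ.+ climb h₄) →-dec
        (Sum.≡-dec Fin._≟_ Fin._≟_ h₁ h₃
          ⊎-dec (target h₂ Fin.≟ source h₁ ×-dec climb h₁ ℤ.+ climb h₂ ℤ.≟ + 0)))))} _

two-climbs : ∀ {a b c h₁ h₂} → Step a h₁ b → Step b h₂ c → + level c ≡ + level a ℤ.+ (climb h₁ ℤ.+ climb h₂)
two-climbs {a} {h₁ = h₁} {h₂} (step _ _ ab) (step _ _ bc) =
  trans bc (trans (cong (ℤ._+ climb h₂) ab) (ℤ.+-assoc (+ level a) (climb h₁) (climb h₂)))

common-neighbours : ∀ {a b c d h₁ h₂ h₃ h₄} → Step a h₁ b → Step b h₂ c → Step a h₃ d → Step d h₄ c →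
  b ≡ d ⊎ c ≡ a
common-neighbours {a} {b} {c} {d} {h₁} {h₂} {h₃} {h₄}
  s₁@(step a≡ b≡ ab) s₂@(step b≡′ c≡ _) s₃@(step a≡′ d≡ ad) s₄@(step d≡′ c≡′ _) = Sum.map b≡d c≡a
  (two-steps-rigid h₁ h₂ (trans (sym b≡) b≡′) h₃ (trans (sym a≡) a≡′) h₄ (trans (sym d≡) d≡′)
    (trans (sym c≡) c≡′ , ∙-cancelˡ (+ level a) _ _ (trans (sym (two-climbs s₁ s₂)) (two-climbs s₃ s₄))))
  where
  b≡d : h₁ ≡ h₃ → b ≡ d
  b≡d refl = level-orbit-injective (ℤ.+-injective (trans ab (sym ad))) (trans b≡ (sym d≡))
  c≡a : target h₂ ≡ source h₁ × climb h₁ ℤ.+ climb h₂ ≡ + 0 → c ≡ a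
  c≡a (orbit≡ , climb≡0) = level-orbit-injective
    (ℤ.+-injective (trans (two-climbs s₁ s₂) (trans (cong (λ k → + level a ℤ.+ k) climb≡0) (ℤ.+-identityʳ (+ level a)))))
    (trans c≡ (trans orbit≡ (sym a≡)))

C₄-free : ∀ n → CycleFree 4 (G n)
C₄-free n cycle = [ (λ eq → case distinct (Fin.toℕ-injective eq) of λ ()) , (λ eq → case distinct (Fin.toℕ-injective eq) of λ ()) ]′
  -- The two paths run from vertex 0 to vertex 2 of the cycle, one through 1 and the other through
  -- 3; a coincidence of 1 with 3 or of 2 with 0 is excluded.
  (common-neighbours (edge (# 0) (# 1) (adjacent (# 0))) (edge (# 1) (# 2) (adjacent (# 1)))
    (edge (# 0) (# 3) (flip (# 3) (# 0) (adjacent (# 3)))) (edge (# 3) (# 2) (flip (# 2) (# 3) (adjacent (# 2)))))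
  where
  open Cycle cycle
  flip : ∀ i j → Graph.Adj (G n) (vertex i) (vertex j) → Graph.Adj (G n) (vertex j) (vertex i)
  flip i j = subst T (Graph.symmetric (G n) (vertex i) (vertex j))
  edge : ∀ i j → (h : Graph.Adj (G n) (vertex i) (vertex j)) →
    Step (toℕ (vertex i)) (proj₁ (adj⇒step {n} {vertex i} {vertex j} h)) (toℕ (vertex j))
  edge i j h = proj₂ (adj⇒step {n} {vertex i} {vertex j} h)

-- The drawing

head-vertex : ∀ l j → head l (inj₂ j) ≡ place l j
head-vertex l j = cong (λ m → place m j) (ℕ.+-identityʳ l)

vertex-segment : ∀ l j → toPoint (place l j) ≈Pt segment (tail l (inj₂ j)) (head l (inj₂ j)) ½I
vertex-segment l j = subst (λ v → toPoint (place l j) ≈Pt segment (place l j) v ½I) (sym (head-vertex l j))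
  (toPoint≈segment (place l j))

-- A degenerate segment has equal ends, so no linear form varies along it.
vertex-not-crossing : ∀ {l j m t} → ¬ CrossingAt l (inj₂ j) m t
vertex-not-crossing {l} {j} (crossing _ _ _ {w} (transverse _ varies)) = varies (cong (det w) (sym (head-vertex l j)))

meet⇒crossing : ∀ l s m t {a b} → Interior a → Interior b →
  segment (tail l s) (head l s) a ≈Pt segment (tail m t) (head m t) b →
  (l ≡ m × s ≡ t) ⊎ CrossingAt l s m t
meet⇒crossing l s m t {a} {b} a-int b-int meet = cases (locate l s m t)
  where
  cases : Position l s m t → (l ≡ m × s ≡ t) ⊎ CrossingAt l s m t
  cases (same l≡m s≡t)       = inj₁ (l≡m , s≡t)
  cases (apart (w , c , sep)) = contradiction meet (separated⇒¬meet {s = a} {t = b} sep a-int b-int)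
  cases (cross c _)          = inj₂ c

-- With an edge for `t` this says that edges avoid vertices, with a vertex that positions are
-- distinct. The vertex is taken as a degenerate segment at its interior parameter ½.
vertex-meets-only-itself : ∀ l j m t {b} → Interior b →
  toPoint (place l j) ≈Pt segment (tail m t) (head m t) b → l ≡ m × inj₂ j ≡ t
vertex-meets-only-itself l j m t {b} b-int h = [ (λ eq → eq) , (λ c → contradiction c vertex-not-crossing) ]′
  (meet⇒crossing l (inj₂ j) m t {½I} {b} ½I-interior b-int
    (≈Pt-trans degenerate (toPoint (place l j)) (segment (tail m t) (head m t) b)
      (≈Pt-sym (toPoint (place l j)) degenerate (vertex-segment l j)) h))
  where
  degenerate : Point
  degenerate = segment (tail l (inj₂ j)) (head l (inj₂ j)) ½I

places-differ : ∀ l j m k → ¬ (l ≡ m × j ≡ k) → ∃[ w ] det w (place l j) ≢ det w (place m k)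
places-differ l j m k differ = cases (locate l (inj₂ j) m (inj₂ k))
  where
  cases : Position l (inj₂ j) m (inj₂ k) → ∃[ w ] det w (place l j) ≢ det w (place m k)
  cases (same l≡m eq) = contradiction (l≡m , Sum.inj₂-injective eq) differ
  cases (cross c _)   = contradiction c vertex-not-crossing
  -- For degenerate segments `strict` compares the doubled values at the two vertices, so the values
  -- differ.
  cases (apart (w , c , separated _ _ _ _ strict)) = w , λ eq →
    ℤ.<-irrefl (cong (λ d → d ℤ.+ d) (sym eq)) (subst₂ (λ p q → det w (place m k) ℤ.+ det w p ℤ.< det w (place l j) ℤ.+ det w q)
      (head-vertex m k) (head-vertex l j) strict)

locus : ∀ {n} → Fin n → ℤ²
locus u = place (level (toℕ u)) (orbit (toℕ u))

vertex-≡ : ∀ {n} {u v : Fin n} → level (toℕ u) ≡ level (toℕ v) → orbit (toℕ u) ≡ orbit (toℕ v) → u ≡ v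
vertex-≡ l≡ o≡ = Fin.toℕ-injective (level-orbit-injective l≡ o≡)

toPoint-locus-injective : ∀ {n} {u v : Fin n} → toPoint (locus u) ≈Pt toPoint (locus v) → u ≡ v
toPoint-locus-injective {u = u} {v} h = vertex-≡ (proj₁ same-place) (Sum.inj₂-injective (proj₂ same-place))
  where
  l m : ℕ
  l = level (toℕ u)
  m = level (toℕ v)
  j k : Fin 6
  j = orbit (toℕ u)
  k = orbit (toℕ v)
  same-place : l ≡ m × inj₂ j ≡ inj₂ k
  same-place = vertex-meets-only-itself l j m (inj₂ k) {½I} ½I-interior
    (≈Pt-trans (toPoint (place l j)) (toPoint (place m k)) (segment (tail m (inj₂ k)) (head m (inj₂ k)) ½I) h (vertex-segment m k))

module _ {n : ℕ} where

  private
    E : Set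
    E = Edge (G n)

  edge-linked : (e : E) → Linked (toℕ (Edge.src e)) (toℕ (Edge.tgt e))
  edge-linked e = [ (λ h → h) , (λ h → contradiction (linked⇒< h) (ℕ.<-asym (Edge.src<tgt e))) ]′
    (adj⇒linked n {Edge.src e} {Edge.tgt e} (Edge.adjacent e))

  edge-type : E → Fin 15
  edge-type e = proj₁ (edge-linked e)

  edge-level : E → ℕ
  edge-level e = level (toℕ (Edge.src e))

  edge-≡ : ∀ {e f} → edge-level e ≡ edge-level f → edge-type e ≡ edge-type f → e ≡ f
  edge-≡ {e} {f} l≡ t≡ = ext (vertex-≡ l≡ (trans (orbit-src e′) (trans (cong (from ∘ edgeShape) t≡) (sym (orbit-src f′)))))
    (vertex-≡ (trans (level-tgt e′) (trans (cong₂ (λ l t → l ℕ.+ rise (edgeShape t)) l≡ t≡) (sym (level-tgt f′))))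
      (trans (orbit-tgt e′) (trans (cong (to ∘ edgeShape) t≡) (sym (orbit-tgt f′)))))
    where
    open LinkedBy
    e′ = proj₂ (edge-linked e)
    f′ = proj₂ (edge-linked f)
    ext : ∀ {e f : E} → Edge.src e ≡ Edge.src f → Edge.tgt e ≡ Edge.tgt f → e ≡ f
    ext {e} {f} refl refl = cong₂ (λ p q → record { src<tgt = p ; adjacent = q })
      (ℕ.<-irrelevant (Edge.src<tgt e) (Edge.src<tgt f)) (T-irrelevant (Edge.adjacent e) (Edge.adjacent f))

  edge-tail edge-head : E → ℤ²
  edge-tail e = tail (edge-level e) (inj₁ (edge-type e))
  edge-head e = head (edge-level e) (inj₁ (edge-type e))

  locus-src : ∀ e → locus (Edge.src e) ≡ edge-tail e
  locus-src e = cong (place (edge-level e)) (LinkedBy.orbit-src (proj₂ (edge-linked e)))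

  locus-tgt : ∀ e → locus (Edge.tgt e) ≡ edge-head e
  locus-tgt e = cong₂ place (LinkedBy.level-tgt (proj₂ (edge-linked e))) (LinkedBy.orbit-tgt (proj₂ (edge-linked e)))

  edge-arc : (e : E) → Arc (toPoint (locus (Edge.src e))) (toPoint (locus (Edge.tgt e)))
  edge-arc e = segment-arc {proj₁ differ} {locus (Edge.src e)} {locus (Edge.tgt e)} (proj₂ differ)
    where
    differ : ∃[ w ] det w (locus (Edge.src e)) ≢ det w (locus (Edge.tgt e))
    differ = places-differ (level (toℕ (Edge.src e))) (orbit (toℕ (Edge.src e))) (level (toℕ (Edge.tgt e))) (orbit (toℕ (Edge.tgt e))) λ (l≡ , o≡) → ℕ.<⇒≢ (Edge.src<tgt e) (level-orbit-injective l≡ o≡)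

  edge-curve : ∀ e a → curve (edge-arc e) a ≡ segment (edge-tail e) (edge-head e) a
  edge-curve e a = cong₂ (λ u v → segment u v a) {locus (Edge.src e)} {edge-tail e} {locus (Edge.tgt e)} {edge-head e}
    (locus-src e) (locus-tgt e)

  drawing : Drawing (G n)
  drawing = record
    { position        = toPoint ∘ locus
    ; distinct        = toPoint-locus-injective
    ; arc             = edge-arc
    ; avoids-vertices = λ e a a-int w h → case
        proj₂ (vertex-meets-only-itself (level (toℕ w)) (orbit (toℕ w)) (edge-level e) (inj₁ (edge-type e)) {a} a-int
          (subst (toPoint (locus w) ≈Pt_) (edge-curve e a) (≈Pt-sym (curve (edge-arc e) a) (toPoint (locus w)) h))) of λ ()
    }

  open Drawing drawing using (Crossing; SameCrossing; CrossedAtMost)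
  open Crossing

  meet-segments : ∀ {e} (c : Crossing e) → segment (edge-tail e) (edge-head e) (param c)
    ≈Pt segment (edge-tail (other c)) (edge-head (other c)) (otherParam c)
  meet-segments {e} c = subst₂ _≈Pt_ (edge-curve e (param c)) (edge-curve (other c) (otherParam c)) (meet c)

  crossing-at : ∀ {e} (c : Crossing e) →
    CrossingAt (edge-level e) (inj₁ (edge-type e)) (edge-level (other c)) (inj₁ (edge-type (other c)))
  crossing-at {e} c = [ (λ (l≡ , t≡) → contradiction (sym (edge-≡ l≡ (Sum.inj₁-injective t≡))) (other≢ c)) , (λ h → h) ]′
    (meet⇒crossing (edge-level e) (inj₁ (edge-type e)) (edge-level (other c)) (inj₁ (edge-type (other c))) {param c} {otherParam c}
      (param-interior c) (other-interior c) (meet-segments c))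

  -- The index fixes the kind and the level of the other edge, hence that edge by `edge-≡`;
  -- transversality then fixes the parameter.
  same-index⇒same-crossing : ∀ {e} (c d : Crossing e) →
    CrossingAt.index (crossing-at c) ≡ CrossingAt.index (crossing-at d) → SameCrossing c d
  same-index⇒same-crossing {e} c d i≡ = other≡ , transverse⇒unique C.is-transverse {param c} {param d} {otherParam c} {otherParam d}
      (meet-segments c) (subst (λ o → segment (edge-tail e) (edge-head e) (param d)
        ≈Pt segment (edge-tail o) (edge-head o) (otherParam d)) (sym other≡) (meet-segments d))
    where
    module C = CrossingAt (crossing-at c)
    module D = CrossingAt (crossing-at d)
    neighbours≡ : (inj₁ (edge-type (other c)) , C.shift) ≡ (inj₁ (edge-type (other d)) , D.shift)
    neighbours≡ = trans (sym C.is-neighbour) (trans (cong (neighbour (inj₁ (edge-type e))) i≡) D.is-neighbour)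
    other≡ : other c ≡ other d
    other≡ = edge-≡ (ℤ.+-injective (trans C.level-shift (trans (cong (λ k → + edge-level e ℤ.+ k) (cong proj₂ neighbours≡)) (sym D.level-shift))))
      (Sum.inj₁-injective (cong proj₁ neighbours≡))

  crossed-at-most-twice : ∀ e → CrossedAtMost 2 e
  -- Three crossings share two indices.
  crossed-at-most-twice e (c , different) = collide (Fin.pigeonhole ℕ.≤-refl (λ i → CrossingAt.index (crossing-at (c i))))
    where
    collide : ¬ (∃[ i ] ∃[ j ] i Fin.< j × CrossingAt.index (crossing-at (c i)) ≡ CrossingAt.index (crossing-at (c j)))
    collide (i , j , i<j , eq) = different i j (Fin.<⇒≢ i<j) (same-index⇒same-crossing (c i) (c j) eq)

2-planar : ∀ n → KPlanar 2 (G n)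
2-planar n = drawing , crossed-at-most-twice

-- The number of edges

edgeShape-injective : ∀ t t′ → from (edgeShape t) ≡ from (edgeShape t′) × to (edgeShape t) ≡ to (edgeShape t′)
  × rise (edgeShape t) ≡ rise (edgeShape t′) → t ≡ t′
edgeShape-injective = toWitness {a? = Fin.all? λ t → Fin.all? λ t′ →
  (from (edgeShape t) Fin.≟ from (edgeShape t′) ×-dec to (edgeShape t) Fin.≟ to (edgeShape t′)
    ×-dec rise (edgeShape t) ℕ.≟ rise (edgeShape t′)) →-dec (t Fin.≟ t′)} _

injection-into-list : ∀ {A : Set} {m} (xs : List A) (f : Fin m → A) → (∀ i → f i ∈ xs) →
  (∀ {i j} → f i ≡ f j → i ≡ j) → m ℕ.≤ List.length xs
injection-into-list xs f f∈xs f-injective = Fin.injective⇒≤ {f = λ i → Any.index (f∈xs i)} λ {i} {j} eq → f-injective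
  (trans (lookup-index (f∈xs i)) (trans (cong (List.lookup xs) eq) (sym (lookup-index (f∈xs j)))))

number-injective : ∀ {l j m k} → number l j ≡ number m k → l ≡ m × j ≡ k
number-injective {l} {j} {m} {k} eq =
    trans (sym (level-number l j)) (trans (cong level eq) (level-number m k))
  , trans (sym (orbit-number l j)) (trans (cong orbit eq) (orbit-number m k))

number-< : ∀ {n l} j → l ℕ.< level n → number l j ℕ.< n
number-< {n} {l} j l<n = begin-strict
  toℕ j ℕ.+ l ℕ.* 6    <⟨ ℕ.+-monoˡ-< (l ℕ.* 6) (Fin.toℕ<n j) ⟩
  suc l ℕ.* 6          ≤⟨ ℕ.*-monoˡ-≤ 6 l<n ⟩
  level n ℕ.* 6        ≤⟨ m/n*n≤m n 6 ⟩
  n                    ∎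
  where open ℕ.≤-Reasoning

module _ (n : ℕ) where

  -- As no edge rises by more than 5, all 15 edges starting on these levels end on complete levels.
  -- For small `n` the truncated subtraction gives 0, so no lower bound on `n` is needed.
  fullLevels : ℕ
  fullLevels = level n ℕ.∸ 5

  tgt< : ∀ {l} → l ℕ.< fullLevels → ∀ t → l ℕ.+ rise (edgeShape t) ℕ.< level n
  tgt< {l} l< t = ℕ.≤-<-trans (ℕ.+-monoʳ-≤ l (rise≤5 (inj₁ t)))
    (ℕ.m≤o∸n⇒m+n≤o (suc l) (ℕ.<⇒≤ (ℕ.m∸n≢0⇒n<m (ℕ.m<n⇒n≢0 l<))) l<)

  src< : ∀ {l} → l ℕ.< fullLevels → l ℕ.< level n
  src< l< = ℕ.<-≤-trans l< (ℕ.m∸n≤m (level n) 5)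

  ends : Fin fullLevels → Fin 15 → Fin n × Fin n
  ends l t = fromℕ< (number-< (from (edgeShape t)) (src< (Fin.toℕ<n l))) , fromℕ< (number-< (to (edgeShape t)) (tgt< (Fin.toℕ<n l) t))

  toℕ-src : ∀ l t → toℕ (proj₁ (ends l t)) ≡ number (toℕ l) (from (edgeShape t))
  toℕ-src l t = Fin.toℕ-fromℕ< _

  toℕ-tgt : ∀ l t → toℕ (proj₂ (ends l t)) ≡ number (toℕ l ℕ.+ rise (edgeShape t)) (to (edgeShape t))
  toℕ-tgt l t = Fin.toℕ-fromℕ< _

  ends-linked : ∀ l t → Linked (toℕ (proj₁ (ends l t))) (toℕ (proj₂ (ends l t)))
  ends-linked l t = subst₂ Linked (sym (toℕ-src l t)) (sym (toℕ-tgt l t)) (t , linked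
    (orbit-number (toℕ l) (from s)) (orbit-number (toℕ l ℕ.+ rise s) (to s))
    (trans (level-number (toℕ l ℕ.+ rise s) (to s)) (cong (ℕ._+ rise s) (sym (level-number (toℕ l) (from s))))))
    where
    s : Shape
    s = edgeShape t

  ends∈edgeList : ∀ l t → ends l t ∈ Graph.edgeList (G n)
  ends∈edgeList l t = ∈-filter⁺ _ (∈-cartesianProduct⁺ (∈-allFin _) (∈-allFin _))
    (linked⇒< (ends-linked l t) , linked⇒adj n {proj₁ (ends l t)} {proj₂ (ends l t)} (ends-linked l t))

  ends-injective : ∀ l t l′ t′ → ends l t ≡ ends l′ t′ → l ≡ l′ × t ≡ t′
  ends-injective l t l′ t′ eq = Fin.toℕ-injective l≡ , edgeShape-injective t t′ (proj₂ src≡ , proj₂ tgt≡ ,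
      ℕ.+-cancelˡ-≡ (toℕ l) _ _ (trans (proj₁ tgt≡) (cong (ℕ._+ rise (edgeShape t′)) (sym l≡))))
    where
    src≡ = number-injective (trans (sym (toℕ-src l t)) (trans (cong (toℕ ∘ proj₁) eq) (toℕ-src l′ t′)))
    tgt≡ = number-injective (trans (sym (toℕ-tgt l t)) (trans (cong (toℕ ∘ proj₂) eq) (toℕ-tgt l′ t′)))
    l≡ : toℕ l ≡ toℕ l′
    l≡ = proj₁ src≡

  edgeCount-lower : fullLevels ℕ.* 15 ℕ.≤ edgeCount (G n)
  edgeCount-lower = injection-into-list (Graph.edgeList (G n)) (λ i → ends (level-of i) (type-of i))
    (λ i → ends∈edgeList (level-of i) (type-of i)) (λ {i} {j} eq → remQuot-injective (ends-injective _ _ _ _ eq))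
    where
    level-of : Fin (fullLevels ℕ.* 15) → Fin fullLevels
    level-of i = proj₁ (remQuot {fullLevels} 15 i)
    type-of : Fin (fullLevels ℕ.* 15) → Fin 15
    type-of i = proj₂ (remQuot {fullLevels} 15 i)
    remQuot-injective : ∀ {i j} → level-of i ≡ level-of j × type-of i ≡ type-of j → i ≡ j
    remQuot-injective {i} {j} (l≡ , t≡) = trans (sym (Fin.combine-remQuot {fullLevels} 15 i))
      (trans (cong₂ combine l≡ t≡) (Fin.combine-remQuot {fullLevels} 15 j))

  -- A level has 6 vertices and contributes 15 edges, so both sides grow by 30 per level. The slack
  -- 180 is 30 for the incomplete last level and 150 for the five levels not counted; halved, it is
  -- the constant 90.
  5n≤2e+180 : 5 ℕ.* n ℕ.≤ 2 ℕ.* edgeCount (G n) ℕ.+ 180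
  5n≤2e+180 = begin
    5 ℕ.* n                                     ≡⟨ cong (5 ℕ.*_) (number-level-orbit n) ⟩
    5 ℕ.* (toℕ (orbit n) ℕ.+ level n ℕ.* 6)     ≤⟨ ℕ.*-monoʳ-≤ 5 (ℕ.+-monoˡ-≤ (level n ℕ.* 6) (ℕ.<⇒≤ (Fin.toℕ<n (orbit n)))) ⟩
    5 ℕ.* (6 ℕ.+ level n ℕ.* 6)                 ≡⟨ eq₁ (level n) ⟩
    30 ℕ.+ 30 ℕ.* level n                       ≤⟨ ℕ.+-monoʳ-≤ 30 (ℕ.*-monoʳ-≤ 30 (ℕ.m≤n+m∸n (level n) 5)) ⟩
    30 ℕ.+ 30 ℕ.* (5 ℕ.+ fullLevels)            ≡⟨ eq₂ fullLevels ⟩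
    2 ℕ.* (fullLevels ℕ.* 15) ℕ.+ 180           ≤⟨ ℕ.+-monoˡ-≤ 180 (ℕ.*-monoʳ-≤ 2 edgeCount-lower) ⟩
    2 ℕ.* edgeCount (G n) ℕ.+ 180               ∎
    where
    open ℕ.≤-Reasoning
    eq₁ : ∀ l → 5 ℕ.* (6 ℕ.+ l ℕ.* 6) ≡ 30 ℕ.+ 30 ℕ.* l
    eq₁ = ℕ-solve-∀
    eq₂ : ∀ l → 30 ℕ.+ 30 ℕ.* (5 ℕ.+ l) ≡ 2 ℕ.* (l ℕ.* 15) ℕ.+ 180
    eq₂ = ℕ-solve-∀

5n≤2e+180⇒5/2n-90≤e : ∀ n e → 5 ℕ.* n ℕ.≤ 2 ℕ.* e ℕ.+ 180 → (+ 5 / 2) * (+ n / 1) - + 90 / 1 ≤ + e / 1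
5n≤2e+180⇒5/2n-90≤e n e h = ≤-via (eq (ι (+ n)) (ι (+ e)))
  (0≤* {½} (ℚ.nonNegative⁻¹ ½) (p≤q⇒0≤q-p (subst₂ _≤_ lhs rhs (ι-mono-≤ (ℤ.+≤+ h)))))
  where
  lhs : ι (+ (5 ℕ.* n)) ≡ ι (+ 5) * ι (+ n)
  lhs = trans (cong ι (ℤ.pos-* 5 n)) (ι-homo-* (+ 5) (+ n))
  rhs : ι (+ (2 ℕ.* e ℕ.+ 180)) ≡ ι (+ 2) * ι (+ e) + ι (+ 180)
  rhs = trans (cong ι (ℤ.pos-+ (2 ℕ.* e) 180)) (trans (ι-homo-+ (+ (2 ℕ.* e)) (+ 180))
    (cong (λ q → q + ι (+ 180)) (trans (cong ι (ℤ.pos-* 2 e)) (ι-homo-* (+ 2) (+ e)))))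
  eq : ∀ n e → ½ * ((+ 2 / 1 * e + + 180 / 1) - + 5 / 1 * n) ≡ e - ((+ 5 / 2) * n - + 90 / 1)
  eq = solve-∀ ℚ-ring

theorem14 : Σ ℚ λ C → Σ ℕ λ N → ((n : ℕ) → N ℕ.≤ n →
    Σ (Graph n) λ G → CycleFree 4 G × KPlanar 2 G ×
    (+ 5 / 2) * (+ n / 1) - C ≤ + (edgeCount G) / 1)
theorem14 = + 90 / 1 , 0 , λ n _ → G n , C₄-free n , 2-planar n , 5n≤2e+180⇒5/2n-90≤e n (edgeCount (G n)) (5n≤2e+180 n)
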